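{- For every integer $r\ge 3$, $\mathrm{cov}(r,2r-1)=r$.
   Context: A complete $r$-uniform $r$-partite hypergraph $K$ has a vertex set $V=V(K)$ partitioned into nonempty classes $V_1\cup\dots\cup V_r$, and its edges are exactly the sets containing one vertex from each class. A $k$-coloring of a hypergraph is an assignment of a color from $[k]=\{1,\dots,k\}$ to each edge (not all $k$ colors need be used). A coloring is spanning if every vertex is incident to edges of every color used in the coloring. For an edge-colored hypergraph $H$, let $H_i$ be the subhypergraph on vertex set $V(H)$ consisting of the edges of color $i$. A hypergraph is connected if it has only one vertex or any two distinct vertices can be connected by a sequence of edges each intersecting the next; every hypergraph is uniquely partitioned into connected components. A monochromatic component of $H$ is (the vertex set of) a connected component of $H_i$ for some color $i$. Let $c(H)$ be the minimum integer $m$ such that $V(H)$ can be covered by $m$ monochromatic components of $H$. $\mathrm{cov}(r,k)$ is the maximum of $c(K)$ when $K$ ranges over all spanning $k$-colorings of complete $r$-uniform $r$-partite hypergraphs. -}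

module Defs where

open import Data.Fin using (Fin)
open import Data.Nat using (ℕ; _≤_; NonZero)
open import Data.Product using (Σ-syntax; ∃-syntax; _×_; _,_; proj₁)
open import Data.Sum using (_⊎_)
open import Level using (Level; 0ℓ)
open import Relation.Binary.Construct.Closure.ReflexiveTransitive using (Star)
open import Relation.Binary.PropositionalEquality using (_≡_)
open import Relation.Unary using (Pred; _≐_) renaming (_∈_ to _∈ₚ_)

private
  variable
    ℓ : Level

IsLeast : Pred ℕ ℓ → ℕ → Set ℓ
IsLeast P m = P m × (∀ n → P n → m ≤ n)

IsGreatest : Pred ℕ ℓ → ℕ → Set ℓ
IsGreatest P m = P m × (∀ n → P n → n ≤ m)

record Hypergraph : Set₁ where
  field
    Vertex : Set
    Edge   : Set
    _∈_    : Vertex → Edge → Set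

  Intersects : Edge → Edge → Set
  Intersects e f = ∃[ w ] (w ∈ e × w ∈ f)

  -- `Star Intersects e f` is a sequence of edges from e to f, each
  -- intersecting the next; the left summand makes every isolated vertex a
  -- component of its own.
  Joined : Vertex → Vertex → Set
  Joined u v = u ≡ v ⊎ (∃[ e ] ∃[ f ] (u ∈ e × v ∈ f × Star Intersects e f))

  -- The components are the classes of the equivalence relation `Joined`.
  IsComponent : Pred Vertex 0ℓ → Set
  IsComponent C = ∃[ v ] (C ≐ Joined v)

record ColoredHypergraph (k : ℕ) : Set₁ where
  field
    hypergraph : Hypergraph
  open Hypergraph hypergraph public using (Vertex; Edge; _∈_)
  field
    color : Edge → Fin k

  colorClass : Fin k → Hypergraph
  colorClass i = record
    { Vertex = Vertex
    ; Edge   = Σ[ e ∈ Edge ] color e ≡ i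
    ; _∈_    = λ v e → v ∈ proj₁ e
    }

  Spanning : Set
  Spanning = ∀ v i → (∃[ e ] color e ≡ i) → ∃[ e ] (v ∈ e × color e ≡ i)

  IsMonochromaticComponent : Pred Vertex 0ℓ → Set
  IsMonochromaticComponent C =
    ∃[ i ] Hypergraph.IsComponent (colorClass i) C

  -- Repetitions in the family are allowed; this does not affect the minimum.
  CoveredBy : ℕ → Set₁
  CoveredBy m =
    Σ[ C ∈ (Fin m → Pred Vertex 0ℓ) ]
      ((∀ j → IsMonochromaticComponent (C j)) × (∀ v → ∃[ j ] v ∈ₚ C j))

  -- c(H) = m
  IsCoverNumber : ℕ → Set₁
  IsCoverNumber = IsLeast CoveredBy

-- The i-th class is `Fin (size i)`.  An edge is represented by the function
-- choosing its vertex in each class.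
completePartite : (r : ℕ) → (Fin r → ℕ) → Hypergraph
completePartite r size = record
  { Vertex = Σ[ i ∈ Fin r ] Fin (size i)
  ; Edge   = (i : Fin r) → Fin (size i)
  ; _∈_    = λ (i , x) e → e i ≡ x
  }

-- Pointwise equal functions represent the same edge, so, in the absence of
-- function extensionality, `color-cong` is what makes `color` a function of
-- the edge.
record CompletePartiteColoring (r k : ℕ) : Set where
  field
    size       : Fin r → ℕ
    nonempty   : ∀ i → NonZero (size i)
    color      : Hypergraph.Edge (completePartite r size) → Fin k
    color-cong : ∀ {e f} → (∀ i → e i ≡ f i) → color e ≡ color f

  coloredHypergraph : ColoredHypergraph k
  coloredHypergraph = record
    { hypergraph = completePartite r size
    ; color      = color
    }

  open ColoredHypergraph coloredHypergraph public
    using (Spanning; IsCoverNumber)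

-- cov(r,k) = m
IsCov : (r k : ℕ) → ℕ → Set₁
IsCov r k = IsGreatest λ n →
  Σ[ K ∈ CompletePartiteColoring r k ]
    (CompletePartiteColoring.Spanning K × CompletePartiteColoring.IsCoverNumber K n)

{-# OPTIONS --safe #-}
-- Upper bound.  Assume no r components cover.  Then every component of every
-- color misses a vertex in each class, so an edge can be chosen greedily to
-- "block" one further color (meet two of its components) with each new vertex.
-- Hence vertices of two different classes agree (lie in the same component) in
-- at least r-1 colors, and vertices of three different classes in at least
-- r-2.  Uncovered vertices produce x, y, z in different classes with a set D of
-- exactly r-2 common colors.  The sets X, Y, Z of colors in which exactly two
-- of them agree have total size at most r+1.  If r ≥ 4, the components of D
-- together with two further ones leave at most r-3 colors in each of X, Y, Z,
-- and an uncovered vertex would, with two of x, y, z from other classes, agree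
-- in at most r-3 colors.  If r = 3, only two shapes of x, y, z are possible up
-- to symmetry, each refuted by a finite search.
--
-- Lower bound.  A vertex carries a level and a set of marked colors (r-1 of
-- them in one class, one in the others); its component in color a is
-- determined by its level if a is marked, and is a common one otherwise.
-- Against r-1 components, mark their colors and take a level they do not use.
module Submission where

open import Data.Bool using (Bool; true; false; T; _∧_)
open import Data.Bool.Properties using (T-∧)
open import Data.Empty using (⊥; ⊥-elim)
open import Data.Fin using (Fin; zero; suc; toℕ; fromℕ<; finToFun; funToFin; inject≤; splitAt; _↑ˡ_; _↑ʳ_)
open import Data.Fin.Patterns
open import Data.Fin.Permutation using (Permutation′; permutation; _⟨$⟩ʳ_; _⟨$⟩ˡ_; inverseˡ; inverseʳ)
open import Data.Fin.Properties
  using (_≟_; any?; all?; pigeonhole; ¬∀⟶∃¬; toℕ<n; toℕ-fromℕ<; toℕ-injective; finToFun-funToFin;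
         inject≤-injective; splitAt-↑ˡ; splitAt-↑ʳ)
open import Data.Fin.Subset
  using (Subset; Nonempty; ∣_∣; inside; outside; _∪_; _∩_; _─_; _-_; _⊆_)
  renaming (_∈_ to _∈ₛ_; _∉_ to _∉ₛ_)
open import Data.Fin.Subset.Properties
  using (nonempty?; Empty-unique; ∣⊥∣≡0; ∣p∣≤n; p⊆q⇒∣p∣≤∣q∣; p⊂q⇒∣p∣<∣q∣; p─q⊆p; x∈p⇒∣p-x∣<∣p∣;
         x∈p∧x∉q⇒x∈p─q; x∈p∩q⁺; x∈p∪q⁻; x∈⁅y⁆⇒x≡y)
open import Data.List as List
  using (List; []; _∷_; length; map; _++_; lookup; foldr; filter; concatMap; upTo; allFin;
         cartesianProduct; cartesianProductWith)
open import Data.List.Membership.Propositional using (_∈_; find; lose)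
open import Data.List.Membership.Propositional.Properties
  using (∈-map⁺; ∈-++⁺ˡ; ∈-++⁺ʳ; ∈-allFin; ∈-concatMap⁺; ∈-upTo⁺; ∈-filter⁺; ∈-tabulate⁺;
         ∈-cartesianProduct⁺; ∈-cartesianProductWith⁺)
import Data.List.Membership.DecPropositional as DecMembership
open import Data.List.Properties using (length-map; length-++; length-tabulate)
open import Data.List.Relation.Unary.All as All using (All; []; _∷_)
import Data.List.Relation.Unary.All.Properties as All
open import Data.List.Relation.Unary.AllPairs using (AllPairs; []; _∷_)
open import Data.List.Relation.Unary.Any as Any using (Any; here; there; index)
open import Data.List.Relation.Unary.Any.Properties using (lookup-index)
open import Data.Nat as ℕ
  using (ℕ; zero; suc; _+_; _*_; _∸_; _^_; _≤_; _<_; z≤n; s≤s; NonZero)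
open import Data.Nat.Properties hiding (_≟_)
open import Data.Nat.Tactic.RingSolver using (solve-∀)
open import Data.Product using (Σ; ∃; ∃₂; _×_; _,_; proj₁; proj₂)
import Data.Product.Properties as Product
open import Data.Sum using (_⊎_; inj₁; inj₂; [_,_])
open import Data.Unit using (tt)
open import Data.Vec as Vec using (Vec; []; _∷_; here; there; tabulate; zipWith) renaming (lookup to _!_)
open import Data.Vec.Properties
  using (lookup⇒[]=; []=⇒lookup; lookup∘tabulate; lookup-zipWith; tabulate-cong)
open import Data.Vec.Relation.Unary.All using ([]; _∷_)
open import Data.Vec.Relation.Unary.AllPairs using ([]; _∷_)
open import Data.Vec.Relation.Unary.Unique.Propositional using (Unique)
open import Data.Vec.Relation.Unary.Unique.Propositional.Properties using (lookup-injective)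
open import Function using (_∘_; id; const)
open import Function.Bundles using (module Equivalence)
open import Level using (0ℓ)
open import Relation.Binary using (DecidableEquality)
open import Relation.Binary.Construct.Closure.ReflexiveTransitive using (Star; ε; _◅_; _◅◅_; reverse)
open import Relation.Binary.PropositionalEquality hiding ([_])
open import Relation.Nullary
  using (¬_; Dec; yes; no; does; contradiction; ¬?; _×-dec_; _⊎-dec_)
open import Relation.Nullary.Decidable
  using (dec-true; ⌊_⌋; toWitness; decidable-stable; ¬¬-excluded-middle)
open import Relation.Unary using (Pred; Decidable)
open import Defs

-- Finite sets

-- Otherwise choosing preimages under `f` would map `Fin m` into the smaller `Fin n`, and a
-- collision would contradict injectivity of `g`.
missed : {A : Set} → DecidableEquality A → ∀ {m n} → n < m →
  (f : Fin n → A) (g : Fin m → A) → (∀ {x y} → g x ≡ g y → x ≡ y) →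
  ∃ λ x → ∀ y → f y ≢ g x
missed _≟A_ {m} {n} n<m f g g-inj with all? (λ x → any? (λ y → f y ≟A g x))
... | no ¬hit =
  let x , ¬∃ = ¬∀⟶∃¬ m _ (λ x → any? (λ y → f y ≟A g x)) ¬hit in x , λ y eq → ¬∃ (y , eq)
... | yes hit with pigeonhole n<m (proj₁ ∘ hit)
...   | i , j , i<j , eq = contradiction (cong toℕ (g-inj (begin
          g i                ≡⟨ proj₂ (hit i) ⟨
          f (proj₁ (hit i))  ≡⟨ cong f eq ⟩
          f (proj₁ (hit j))  ≡⟨ proj₂ (hit j) ⟩
          g j                ∎))) (<⇒≢ i<j)
  where open ≡-Reasoning

module _ {n : ℕ} {P : Pred (Fin n) 0ℓ} (P? : Decidable P) where

  filterₛ : Subset n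
  filterₛ = tabulate (does ∘ P?)

  ∈-filterₛ⁺ : ∀ {a} → P a → a ∈ₛ filterₛ
  ∈-filterₛ⁺ {a} p = lookup⇒[]= a filterₛ (trans (lookup∘tabulate _ a) (dec-true (P? a) p))

  ∈-filterₛ⁻ : ∀ {a} → a ∈ₛ filterₛ → P a
  ∈-filterₛ⁻ {a} a∈ with P? a in eq
  ... | yes p = p
  ... | no ¬p = contradiction
    (trans (sym ([]=⇒lookup a∈)) (trans (lookup∘tabulate _ a) (cong does eq))) λ ()

toListₛ : ∀ {n} → Subset n → List (Fin n)
toListₛ []            = []
toListₛ (inside ∷ p)  = zero ∷ map suc (toListₛ p)
toListₛ (outside ∷ p) = map suc (toListₛ p)

length-toListₛ : ∀ {n} (p : Subset n) → length (toListₛ p) ≡ ∣ p ∣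
length-toListₛ []            = refl
length-toListₛ (inside ∷ p)  = cong suc (trans (length-map suc (toListₛ p)) (length-toListₛ p))
length-toListₛ (outside ∷ p) = trans (length-map suc (toListₛ p)) (length-toListₛ p)

∈-toListₛ : ∀ {n} {p : Subset n} {a} → a ∈ₛ p → a ∈ toListₛ p
∈-toListₛ {p = inside ∷ p}  here      = here refl
∈-toListₛ {p = inside ∷ p}  (there i) = there (∈-map⁺ suc (∈-toListₛ i))
∈-toListₛ {p = outside ∷ p} (there i) = ∈-map⁺ suc (∈-toListₛ i)

∣p∣≤∣p─q∣+∣q∣ : ∀ {n} (p q : Subset n) → ∣ p ∣ ≤ ∣ p ─ q ∣ + ∣ q ∣
∣p∣≤∣p─q∣+∣q∣ []            []            = z≤n
∣p∣≤∣p─q∣+∣q∣ (inside ∷ p)  (inside ∷ q)  =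
  ≤-trans (s≤s (∣p∣≤∣p─q∣+∣q∣ p q)) (≤-reflexive (sym (+-suc _ _)))
∣p∣≤∣p─q∣+∣q∣ (inside ∷ p)  (outside ∷ q) = s≤s (∣p∣≤∣p─q∣+∣q∣ p q)
∣p∣≤∣p─q∣+∣q∣ (outside ∷ p) (inside ∷ q)  =
  ≤-trans (∣p∣≤∣p─q∣+∣q∣ p q) (+-monoʳ-≤ ∣ p ─ q ∣ (n≤1+n _))
∣p∣≤∣p─q∣+∣q∣ (outside ∷ p) (outside ∷ q) = ∣p∣≤∣p─q∣+∣q∣ p q

disjoint⇒∣p∣+∣q∣≤∣p∪q∣ : ∀ {n} (p q : Subset n) → (∀ {a} → a ∈ₛ p → a ∉ₛ q) →
  ∣ p ∣ + ∣ q ∣ ≤ ∣ p ∪ q ∣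
disjoint⇒∣p∣+∣q∣≤∣p∪q∣ []            []            dis = z≤n
disjoint⇒∣p∣+∣q∣≤∣p∪q∣ (inside ∷ p)  (inside ∷ q)  dis = ⊥-elim (dis here here)
disjoint⇒∣p∣+∣q∣≤∣p∪q∣ (inside ∷ p)  (outside ∷ q) dis =
  s≤s (disjoint⇒∣p∣+∣q∣≤∣p∪q∣ p q λ i j → dis (there i) (there j))
disjoint⇒∣p∣+∣q∣≤∣p∪q∣ (outside ∷ p) (inside ∷ q)  dis =
  ≤-trans (≤-reflexive (+-suc _ _)) (s≤s (disjoint⇒∣p∣+∣q∣≤∣p∪q∣ p q λ i j → dis (there i) (there j)))
disjoint⇒∣p∣+∣q∣≤∣p∪q∣ (outside ∷ p) (outside ∷ q) dis =
  disjoint⇒∣p∣+∣q∣≤∣p∪q∣ p q λ i j → dis (there i) (there j)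

-- The first `m` elements are dropped, or all of them if there are fewer. In the covers below `q`
-- holds the colors used and `p ─ q` those left over.
trim : ∀ {n} (p : Subset n) (m : ℕ) → ∃ λ q → q ⊆ p × ∣ q ∣ ≡ ∣ p ∣ ∸ m × ∣ p ─ q ∣ ≤ m
trim []            m       = [] , (λ ()) , sym (0∸n≡0 m) , z≤n
trim (outside ∷ p) m       =
  let q , q⊆p , eq , le = trim p m in
  outside ∷ q , (λ { (there i) → there (q⊆p i) }) , eq , le
trim (inside ∷ p)  zero    =
  let q , q⊆p , eq , le = trim p zero in
  inside ∷ q , (λ { here → here ; (there i) → there (q⊆p i) }) , cong suc eq , le
trim (inside ∷ p)  (suc m) =
  let q , q⊆p , eq , le = trim p m in
  outside ∷ q , (λ { (there i) → there (q⊆p i) }) , eq , s≤s le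

∸-superadditive : ∀ s x y → (x ∸ s) + (y ∸ s) ≤ (x + y) ∸ s
∸-superadditive s x y with ≤-total s x
... | inj₁ s≤x = ≤-trans (+-monoʳ-≤ (x ∸ s) (m∸n≤m y s)) (≤-reflexive (sym (+-∸-comm y s≤x)))
... | inj₂ x≤s rewrite m≤n⇒m∸n≡0 x≤s = ∸-monoˡ-≤ s (m≤n+m y x)

empty⇒∣p∣≡0 : ∀ {n} {p : Subset n} → ¬ Nonempty p → ∣ p ∣ ≡ 0
empty⇒∣p∣≡0 {n} empty = trans (cong ∣_∣ (Empty-unique empty)) (∣⊥∣≡0 n)

x∈p─q⇒x∉q : ∀ {n} (p q : Subset n) {x} → x ∈ₛ p ─ q → x ∉ₛ q
x∈p─q⇒x∉q (_ ∷ p) (inside ∷ q) ()        here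
x∈p─q⇒x∉q (_ ∷ p) (_ ∷ q)      (there i) (there j) = x∈p─q⇒x∉q p q i j

-- Blocking colors

-- A coloring without a cover by r components, seen through its components:
-- `name a v` identifies the component of v in color a.
record System (r k : ℕ) : Set₁ where
  field
    V         : Set
    cls       : V → Fin r
    name      : Fin k → V → ℕ
    inhabited : ∀ j → ∃ λ v → cls v ≡ j
    mono      : ∀ (e : Fin r → V) → (∀ i → cls (e i) ≡ i) →
                ∃ λ a → ∀ (i j : Fin r) → name a (e i) ≡ name a (e j)
    avoid     : ∀ u a j → j ≢ cls u → ∃ λ w → cls w ≡ j × name a w ≢ name a u
    uncovered : ∀ (L : List (Fin k × ℕ)) → length L ≤ r → ∃ λ q → All (λ (a , n) → name a q ≢ n) L

module Blocking {r k : ℕ} (S : System r k) where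
  open System S

  private
    place : V → (Fin r → V) → Fin r → V
    place u e i with i ≟ cls u
    ... | yes _ = u
    ... | no _  = e i

    place-cls : ∀ u {e} → (∀ i → cls (e i) ≡ i) → ∀ i → cls (place u e i) ≡ i
    place-cls u tr i with i ≟ cls u
    ... | yes eq = sym eq
    ... | no _   = tr i

    place-≡ : ∀ u e → place u e (cls u) ≡ u
    place-≡ u e with cls u ≟ cls u
    ... | yes _ = refl
    ... | no ≢  = contradiction refl ≢

    place-≢ : ∀ u e {i} → i ≢ cls u → place u e i ≡ e i
    place-≢ u e {i} i≢ with i ≟ cls u
    ... | yes eq = contradiction eq i≢
    ... | no _   = refl

    transversal : List V → Fin r → V
    transversal = foldr place (proj₁ ∘ inhabited)

    transversal-cls : ∀ us i → cls (transversal us i) ≡ i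
    transversal-cls []       = proj₂ ∘ inhabited
    transversal-cls (u ∷ us) = place-cls u (transversal-cls us)

    transversal-∈ : ∀ {us} → AllPairs (λ u v → cls u ≢ cls v) us →
      ∀ {u} → u ∈ us → transversal us (cls u) ≡ u
    transversal-∈ (_ ∷ _)   (here refl) = place-≡ _ _
    transversal-∈ (d ∷ ds)  (there u∈)  =
      trans (place-≢ _ _ (≢-sym (All.lookup d u∈))) (transversal-∈ ds u∈)

  -- Each color of L is blocked by a vertex of a fresh class outside the
  -- component of u in that color.
  blocked : ∀ u us → AllPairs (λ u v → cls u ≢ cls v) (u ∷ us) →
    (L : Subset k) → (∀ a → (∀ {v} → v ∈ us → name a v ≡ name a u) → a ∈ₛ L) →
    ∣ L ∣ + length (u ∷ us) ≤ r → ⊥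
  blocked u us ds L left size = go ∣ L ∣ us ds L left size ≤-refl
    where
    go : ∀ m us → AllPairs (λ u v → cls u ≢ cls v) (u ∷ us) →
      (L : Subset k) → (∀ a → (∀ {v} → v ∈ us → name a v ≡ name a u) → a ∈ₛ L) →
      ∣ L ∣ + length (u ∷ us) ≤ r → ∣ L ∣ ≤ m → ⊥
    -- `L` contains every color not yet blocked. If it is empty, the color of an edge through `u`
    -- and `us` is one in which they all agree, hence a member of `L`. The bound `m` is the
    -- recursion measure.
    go m us ds L left size ∣L∣≤m with nonempty? L
    ... | no empty = empty (a , left a λ {v} v∈ → begin
        name a v                               ≡⟨ cong (name a) (transversal-∈ ds (there v∈)) ⟨
        name a (transversal (u ∷ us) (cls v))  ≡⟨ same (cls v) (cls u) ⟩
        name a (transversal (u ∷ us) (cls u))  ≡⟨ cong (name a) (transversal-∈ ds (here refl)) ⟩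
        name a u                               ∎)
      where
      open ≡-Reasoning
      color = mono (transversal (u ∷ us)) (transversal-cls (u ∷ us))
      a = proj₁ color
      same = proj₂ color
    go zero    us ds L left size ∣L∣≤0 | yes (a , a∈) =
      contradiction (<-≤-trans (x∈p⇒∣p-x∣<∣p∣ a∈) ∣L∣≤0) λ ()
    go (suc m) us ds L left size ∣L∣≤m | yes (a , a∈) =
      go m (w ∷ us) (extend ds) (L - a) left′
        (≤-trans (≤-reflexive (+-suc _ _)) (≤-trans (+-monoˡ-≤ _ smaller) size))
        (≤-pred (<-≤-trans smaller ∣L∣≤m))
      where
      smaller = x∈p⇒∣p-x∣<∣p∣ a∈
      -- `L` still has a color, so the size bound leaves a class without a chosen vertex.
      room : length (u ∷ us) < r
      room = ≤-trans (+-monoˡ-≤ _ (≤-trans (s≤s z≤n) smaller)) size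
      free = missed _≟_ room (cls ∘ lookup (u ∷ us)) id id
      j = proj₁ free
      fresh : ∀ {v} → v ∈ u ∷ us → cls v ≢ j
      fresh v∈ eq = proj₂ free (index v∈) (trans (cong cls (sym (lookup-index v∈))) eq)
      found = avoid u a j (≢-sym (fresh (here refl)))
      w = proj₁ found
      w∈j = proj₁ (proj₂ found)
      extend : AllPairs (λ u v → cls u ≢ cls v) (u ∷ us) → AllPairs (λ u v → cls u ≢ cls v) (u ∷ w ∷ us)
      extend (d ∷ ds) = ((λ eq → fresh (here refl) (trans eq w∈j)) ∷ d)
        ∷ All.tabulate (λ v∈ eq → fresh (there v∈) (trans (sym eq) w∈j)) ∷ ds
      left′ : ∀ b → (∀ {v} → v ∈ w ∷ us → name b v ≡ name b u) → b ∈ₛ L - a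
      left′ b same = x∈p∧x∉q⇒x∈p─q (left b (same ∘ there)) λ b∈ →
        proj₂ (proj₂ found) (subst (λ b → name b w ≡ name b u) (x∈⁅y⁆⇒x≡y a b∈) (same (here refl)))

  -- Agreement of vertices, and tight triples

  agree? : ∀ u v → Decidable (λ a → name a v ≡ name a u)
  agree? u v a = name a v ℕ.≟ name a u

  agree₃? : ∀ u v w → Decidable (λ a → name a v ≡ name a u × name a w ≡ name a u)
  agree₃? u v w a = agree? u v a ×-dec agree? u w a

  agree : V → V → Subset k
  agree u v = filterₛ (agree? u v)

  agree₃ : V → V → V → Subset k
  agree₃ u v w = filterₛ (agree₃? u v w)

  -- Blocking each color of `L` takes one new class besides those of `u` and `v`. Hence vertices of
  -- different classes agree in at least r - 1 colors.
  blocked₂ : ∀ {u v} → cls u ≢ cls v → ∀ L → agree u v ⊆ L → ∣ L ∣ + 2 ≤ r → ⊥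
  blocked₂ {u} {v} u≢v L ⊆L = blocked u (v ∷ []) ((u≢v ∷ []) ∷ [] ∷ []) L
    λ a same → ⊆L (∈-filterₛ⁺ (agree? u v) (same (here refl)))

  -- The same with three starting vertices: they have at least r - 2 common colors.
  blocked₃ : ∀ {u v w} → cls u ≢ cls v → cls u ≢ cls w → cls v ≢ cls w →
    ∀ L → agree₃ u v w ⊆ L → ∣ L ∣ + 3 ≤ r → ⊥
  blocked₃ {u} {v} {w} u≢v u≢w v≢w L ⊆L = blocked u (v ∷ w ∷ []) ((u≢v ∷ u≢w ∷ []) ∷ (v≢w ∷ []) ∷ [] ∷ []) L
    λ a same → ⊆L (∈-filterₛ⁺ (agree₃? u v w) (same (here refl) , same (there (here refl))))

  at : V → Subset k → List (Fin k × ℕ)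
  at u p = map (λ a → a , name a u) (toListₛ p)

  length-at : ∀ u p → length (at u p) ≡ ∣ p ∣
  length-at u p = trans (length-map _ (toListₛ p)) (length-toListₛ p)

  ∈-at : ∀ u {p a} → a ∈ₛ p → (a , name a u) ∈ at u p
  ∈-at u a∈ = ∈-map⁺ _ (∈-toListₛ a∈)

  Off : V → V → Subset k → Set
  Off q u p = ∀ {a} → a ∈ₛ p → name a q ≢ name a u

  -- By `blocked₃` such a triple has exactly r - 2 common colors, the fewest possible.
  record Tight : Set where
    field
      x y z         : V
      x≢y           : cls x ≢ cls y
      x≢z           : cls x ≢ cls z
      y≢z           : cls y ≢ cls z
      ∣agree₃∣+2≤r : ∣ agree₃ x y z ∣ + 2 ≤ r

  module _ (3≤r : 3 ≤ r) (k+1≤2r : k + 1 ≤ r + r) where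

    private
      class-other-than : (us : List V) → length us ≤ 2 → ∃ λ v → ∀ {u} → u ∈ us → cls u ≢ cls v
      class-other-than us two =
        let j , miss = missed _≟_ (<-≤-trans (s≤s two) 3≤r) (cls ∘ lookup us) id id
            v , v∈j = inhabited j
        in v , λ u∈ eq → miss (index u∈) (trans (cong cls (sym (lookup-index u∈))) (trans eq v∈j))

      -- The agreement set is disjoint from the r colors of `p`, so it has at most k - r, hence at
      -- most r - 1 elements.
      thin : ∀ w q p → ∣ p ∣ ≡ r → Off q w p → ∣ agree w q ∣ + 1 ≤ r
      thin w q p ∣p∣≡r off = +-cancelʳ-≤ r _ _ (begin
        ∣ agree w q ∣ + 1 + r      ≡⟨ swap ∣ agree w q ∣ r ⟩
        ∣ agree w q ∣ + r + 1      ≡⟨ cong (λ n → ∣ agree w q ∣ + n + 1) ∣p∣≡r ⟨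
        ∣ agree w q ∣ + ∣ p ∣ + 1  ≤⟨ +-monoˡ-≤ 1 (disjoint⇒∣p∣+∣q∣≤∣p∪q∣ (agree w q) p
                                        λ a∈ a∈p → off a∈p (∈-filterₛ⁻ (agree? w q) a∈)) ⟩
        ∣ agree w q ∪ p ∣ + 1      ≤⟨ +-monoˡ-≤ 1 (∣p∣≤n (agree w q ∪ p)) ⟩
        k + 1                      ≤⟨ k+1≤2r ⟩
        r + r                      ∎)
        where
        open ≤-Reasoning
        swap : ∀ a r → a + 1 + r ≡ a + r + 1
        swap = solve-∀

    -- Cover by r components of u in which v agrees with it: an uncovered vertex
    -- agrees with neither u nor v in these r colors.
    sparser-pair : ∀ {u v} → cls u ≢ cls v → r ≤ ∣ agree u v ∣ →
      ∃₂ λ u v → cls u ≢ cls v × ∣ agree u v ∣ + 1 ≤ r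
    sparser-pair {u} {v} u≢v r≤
      -- Dropping the surplus over r leaves exactly r colors, as many components as `uncovered`
      -- allows.
      with trim (agree u v) (∣ agree u v ∣ ∸ r)
    ... | p , p⊆ , ∣p∣≡∸ , _
      with uncovered (at u p) (≤-reflexive (trans (length-at u p) (trans ∣p∣≡∸ (m∸[m∸n]≡n r≤))))
    ... | q , off with cls u ≟ cls q
    ...   | no u≢q  = u , q , u≢q ,
      thin u q p (trans ∣p∣≡∸ (m∸[m∸n]≡n r≤)) λ a∈ → All.lookup off (∈-at u a∈)
    ...   | yes u≡q = v , q , (λ v≡q → u≢v (trans u≡q (sym v≡q))) ,
      thin v q p (trans ∣p∣≡∸ (m∸[m∸n]≡n r≤)) λ a∈ eq →
        All.lookup off (∈-at u a∈) (trans eq (∈-filterₛ⁻ (agree? u v) (p⊆ a∈)))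

    sparse-pair : ∃₂ λ u v → cls u ≢ cls v × ∣ agree u v ∣ + 1 ≤ r
    sparse-pair with class-other-than [] z≤n
    ... | u , _ with class-other-than (u ∷ []) (s≤s z≤n)
    ...   | v , u≢v with ∣ agree u v ∣ + 1 ℕ.≤? r
    ...     | yes few = u , v , u≢v (here refl) , few
    ...     | no many = sparser-pair (u≢v (here refl))
      (≤-pred (≤-trans (≰⇒> many) (≤-reflexive (+-comm _ 1))))

    -- A sparse pair has at most r - 1 common colors. Taking `z` in a third class, outside the
    -- component of `x` in one of them, removes that color.
    tight : Tight
    tight with sparse-pair
    ... | x , y , x≢y , few with class-other-than (x ∷ y ∷ []) ≤-refl
    ...   | v , v-other with nonempty? (agree x y)
    ...     | no none = ⊥-elim (blocked₂ x≢y (agree x y) id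
      (≤-trans (≤-reflexive (cong (_+ 2) (empty⇒∣p∣≡0 none))) (≤-trans (n≤1+n 2) 3≤r)))
    ...     | yes (a , a∈) with avoid x a (cls v) (≢-sym (v-other (here refl)))
    ...       | z , z∈v , z≁x = record
      { x = x ; y = y ; z = z
      ; x≢y = x≢y
      ; x≢z = λ eq → v-other (here refl) (trans eq z∈v)
      ; y≢z = λ eq → v-other (there (here refl)) (trans eq z∈v)
      ; ∣agree₃∣+2≤r = begin
          ∣ agree₃ x y z ∣ + 2         ≡⟨ +-suc _ 1 ⟩
          suc ∣ agree₃ x y z ∣ + 1     ≤⟨ +-monoˡ-≤ 1 (p⊂q⇒∣p∣<∣q∣ (sub , a , a∈ , a∉)) ⟩
          ∣ agree x y ∣ + 1            ≤⟨ few ⟩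
          r                            ∎
      }
      where
      open ≤-Reasoning
      sub : agree₃ x y z ⊆ agree x y
      sub b∈ = ∈-filterₛ⁺ (agree? x y) (proj₁ (∈-filterₛ⁻ (agree₃? x y z) b∈))
      a∉ : a ∉ₛ agree₃ x y z
      a∉ a∈₃ = z≁x (proj₂ (∈-filterₛ⁻ (agree₃? x y z) a∈₃))

-- The case r ≥ 4

-- Passing to predecessors lowers the sum to at most 2 + s, and subtracting s from every term leaves
-- no more than subtracting it once from the sum. With s = r - 4 this counts the colors in excess of
-- r - 3 in each of X, Y, Z.
excess≤2 : ∀ s {x y z} → 1 ≤ x → 1 ≤ y → 1 ≤ z → x + (y + z) ≤ 5 + s →
  (x ∸ suc s) + ((y ∸ suc s) + (z ∸ suc s)) ≤ 2
excess≤2 s {suc x} {suc y} {suc z} _ _ _ le = begin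
  (x ∸ s) + ((y ∸ s) + (z ∸ s))  ≤⟨ +-monoʳ-≤ (x ∸ s) (∸-superadditive s y z) ⟩
  (x ∸ s) + ((y + z) ∸ s)        ≤⟨ ∸-superadditive s x (y + z) ⟩
  (x + (y + z)) ∸ s              ≤⟨ ∸-monoˡ-≤ s le′ ⟩
  (2 + s) ∸ s                    ≡⟨ m+n∸n≡m 2 s ⟩
  2                              ∎
  where
  open ≤-Reasoning
  le′ : x + (y + z) ≤ 2 + s
  le′ = +-cancelˡ-≤ 3 _ _ (≤-trans (≤-reflexive (shift x y z)) le)
    where
    shift : ∀ x y z → 3 + (x + (y + z)) ≡ suc x + (suc y + suc z)
    shift = solve-∀

module Profile {r k : ℕ} (S : System r k) (k+1≤2r : k + 1 ≤ r + r) (t : Blocking.Tight S) where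
  open System S
  open Blocking S
  open Tight t

  D : Subset k
  D = agree₃ x y z

  only? : ∀ u v w → Decidable (λ a → name a v ≡ name a w × name a u ≢ name a v)
  only? u v w a = name a v ℕ.≟ name a w ×-dec ¬? (name a u ℕ.≟ name a v)

  only : V → V → V → Subset k
  only u v w = filterₛ (only? u v w)

  private
    only⁻ : ∀ {u v w a} → a ∈ₛ only u v w → name a v ≡ name a w × name a u ≢ name a v
    only⁻ {u} {v} {w} = ∈-filterₛ⁻ (only? u v w)

    D⁻ : ∀ {a} → a ∈ₛ D → name a y ≡ name a x × name a z ≡ name a x
    D⁻ = ∈-filterₛ⁻ (agree₃? x y z)

  ∣D∣≡r∸2 : ∣ D ∣ + 2 ≡ r
  ∣D∣≡r∸2 = ≤-antisym ∣agree₃∣+2≤r (≤-pred (≤-trans (≰⇒> (blocked₃ x≢y x≢z y≢z D id)) (≤-reflexive (+-suc _ 2))))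

  -- Otherwise `v` and `w` agree only in colors of `D`, that is in at most r - 2 colors, against
  -- `blocked₂`. The premise about `D` lets `u`, `v`, `w` be any ordering of the triple.
  only-nonempty : ∀ {u v w} → cls v ≢ cls w →
    (∀ {a} → name a u ≡ name a v → name a v ≡ name a w → a ∈ₛ D) → 1 ≤ ∣ only u v w ∣
  only-nonempty {u} {v} {w} v≢w common with 1 ℕ.≤? ∣ only u v w ∣
  ... | yes 1≤ = 1≤
  ... | no 1≰  = ⊥-elim (blocked₂ v≢w (agree v w) id (begin
    ∣ agree v w ∣ + 2                  ≤⟨ +-monoˡ-≤ 2 (∣p∣≤∣p─q∣+∣q∣ (agree v w) D) ⟩
    ∣ agree v w ─ D ∣ + ∣ D ∣ + 2      ≤⟨ +-monoˡ-≤ 2 (+-monoˡ-≤ ∣ D ∣ (p⊆q⇒∣p∣≤∣q∣ λ {a} → sub {a})) ⟩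
    ∣ only u v w ∣ + ∣ D ∣ + 2         ≡⟨ cong (λ n → n + ∣ D ∣ + 2) (n<1⇒n≡0 (≰⇒> 1≰)) ⟩
    ∣ D ∣ + 2                          ≤⟨ ∣agree₃∣+2≤r ⟩
    r                                  ∎))
    where
    open ≤-Reasoning
    sub : agree v w ─ D ⊆ only u v w
    sub {a} a∈ = ∈-filterₛ⁺ (only? u v w)
      (v≡w , λ u≡v → x∈p─q⇒x∉q (agree v w) D a∈ (common u≡v v≡w))
      where
      v≡w = sym (∈-filterₛ⁻ (agree? v w) (p─q⊆p (agree v w) D a∈))

  onlyˣ≥1 : 1 ≤ ∣ only x y z ∣
  onlyˣ≥1 = only-nonempty y≢z λ x≡y y≡z →
    ∈-filterₛ⁺ (agree₃? x y z) (sym x≡y , sym (trans x≡y y≡z))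

  onlyʸ≥1 : 1 ≤ ∣ only y x z ∣
  onlyʸ≥1 = only-nonempty x≢z λ y≡x x≡z → ∈-filterₛ⁺ (agree₃? x y z) (y≡x , sym x≡z)

  onlyᶻ≥1 : 1 ≤ ∣ only z x y ∣
  onlyᶻ≥1 = only-nonempty x≢y λ z≡x x≡y → ∈-filterₛ⁺ (agree₃? x y z) (sym x≡y , z≡x)

  private
    disYZ : ∀ {a} → a ∈ₛ only y x z → a ∉ₛ only z x y
    disYZ a∈ a∈′ = proj₂ (only⁻ a∈) (sym (proj₁ (only⁻ a∈′)))

    disX : ∀ {a} → a ∈ₛ only x y z → a ∉ₛ only y x z ∪ only z x y
    disX a∈ a∈′ with x∈p∪q⁻ (only y x z) (only z x y) a∈′
    ... | inj₁ a∈ʸ = proj₂ (only⁻ a∈) (trans (proj₁ (only⁻ a∈ʸ)) (sym (proj₁ (only⁻ a∈))))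
    ... | inj₂ a∈ᶻ = proj₂ (only⁻ a∈) (proj₁ (only⁻ a∈ᶻ))

    disD : ∀ {a} → a ∈ₛ D → a ∉ₛ only x y z ∪ (only y x z ∪ only z x y)
    disD a∈ a∈′ with x∈p∪q⁻ (only x y z) _ a∈′ | D⁻ a∈
    ... | inj₁ a∈ˣ | y≡x , z≡x = proj₂ (only⁻ a∈ˣ) (sym y≡x)
    ... | inj₂ a∈″ | y≡x , z≡x with x∈p∪q⁻ (only y x z) _ a∈″
    ...   | inj₁ a∈ʸ = proj₂ (only⁻ a∈ʸ) y≡x
    ...   | inj₂ a∈ᶻ = proj₂ (only⁻ a∈ᶻ) z≡x

  total : ∣ D ∣ + (∣ only x y z ∣ + (∣ only y x z ∣ + ∣ only z x y ∣)) ≤ k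
  total = begin
    ∣ D ∣ + (∣ X ∣ + (∣ Y ∣ + ∣ Z ∣))  ≤⟨ +-monoʳ-≤ ∣ D ∣ (+-monoʳ-≤ ∣ X ∣ (disjoint⇒∣p∣+∣q∣≤∣p∪q∣ Y Z disYZ)) ⟩
    ∣ D ∣ + (∣ X ∣ + ∣ Y ∪ Z ∣)        ≤⟨ +-monoʳ-≤ ∣ D ∣ (disjoint⇒∣p∣+∣q∣≤∣p∪q∣ X (Y ∪ Z) disX) ⟩
    ∣ D ∣ + ∣ X ∪ (Y ∪ Z) ∣            ≤⟨ disjoint⇒∣p∣+∣q∣≤∣p∪q∣ D (X ∪ (Y ∪ Z)) disD ⟩
    ∣ D ∪ (X ∪ (Y ∪ Z)) ∣              ≤⟨ ∣p∣≤n (D ∪ (X ∪ (Y ∪ Z))) ⟩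
    k                                  ∎
    where
    open ≤-Reasoning
    X = only x y z
    Y = only y x z
    Z = only z x y

  -- The r - 2 colors of `D` leave at most (2r - 1) - (r - 2) = r + 1 others.
  ∣onlies∣≤1+r : ∣ only x y z ∣ + (∣ only y x z ∣ + ∣ only z x y ∣) ≤ suc r
  ∣onlies∣≤1+r = +-cancelˡ-≤ (∣ D ∣ + 1) _ _ (begin
    ∣ D ∣ + 1 + n      ≡⟨ swap ∣ D ∣ n ⟩
    ∣ D ∣ + n + 1      ≤⟨ +-monoˡ-≤ 1 total ⟩
    k + 1              ≤⟨ k+1≤2r ⟩
    r + r              ≡⟨ cong (_+ r) ∣D∣≡r∸2 ⟨
    ∣ D ∣ + 2 + r      ≡⟨ shift ∣ D ∣ r ⟩
    ∣ D ∣ + 1 + suc r  ∎)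
    where
    open ≤-Reasoning
    n = ∣ only x y z ∣ + (∣ only y x z ∣ + ∣ only z x y ∣)
    swap : ∀ d n → d + 1 + n ≡ d + n + 1
    swap = solve-∀
    shift : ∀ d r → d + 2 + r ≡ d + 1 + suc r
    shift = solve-∀

  -- The cover consists of D and of as many colors from X, Y, Z as are needed to
  -- leave at most r - 3 = suc s colors in each of them.
  r≱4 : ∀ s → r ≢ 4 + s
  r≱4 s r≡4+s with trim (only x y z) (suc s) | trim (only y x z) (suc s) | trim (only z x y) (suc s)
  ... | pX , pX⊆ , ∣pX∣ , restX | pY , pY⊆ , ∣pY∣ , restY | pZ , pZ⊆ , ∣pZ∣ , restZ
    -- In colors of `only x y z` the shared component is that of `y`; in the other two sets it is
    -- that of `x`.
    with uncovered (at x D ++ at y pX ++ at x pY ++ at x pZ) short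
    where
    short : length (at x D ++ at y pX ++ at x pY ++ at x pZ) ≤ r
    short = begin
      length (at x D ++ at y pX ++ at x pY ++ at x pZ)
        ≡⟨ trans (length-++ (at x D)) (cong₂ _+_ (length-at x D)
             (trans (length-++ (at y pX)) (cong₂ _+_ (length-at y pX)
               (trans (length-++ (at x pY)) (cong₂ _+_ (length-at x pY) (length-at x pZ)))))) ⟩
      ∣ D ∣ + (∣ pX ∣ + (∣ pY ∣ + ∣ pZ ∣))
        ≡⟨ cong (∣ D ∣ +_) (cong₂ _+_ ∣pX∣ (cong₂ _+_ ∣pY∣ ∣pZ∣)) ⟩
      ∣ D ∣ + ((∣ only x y z ∣ ∸ suc s) + ((∣ only y x z ∣ ∸ suc s) + (∣ only z x y ∣ ∸ suc s)))
        ≤⟨ +-monoʳ-≤ ∣ D ∣ (excess≤2 s onlyˣ≥1 onlyʸ≥1 onlyᶻ≥1 (≤-trans ∣onlies∣≤1+r (≤-reflexive (cong suc r≡4+s)))) ⟩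
      ∣ D ∣ + 2
        ≤⟨ ∣agree₃∣+2≤r ⟩
      r ∎
      where open ≤-Reasoning
  ... | q , off = refuted
    where
    offD : Off q x D
    offD a∈ = All.lookup off (∈-++⁺ˡ (∈-at x a∈))

    offX : Off q y pX
    offX a∈ = All.lookup off (∈-++⁺ʳ (at x D) (∈-++⁺ˡ (∈-at y a∈)))

    offY : Off q x pY
    offY a∈ = All.lookup off (∈-++⁺ʳ (at x D) (∈-++⁺ʳ (at y pX) (∈-++⁺ˡ (∈-at x a∈))))

    offZ : Off q x pZ
    offZ a∈ = All.lookup off (∈-++⁺ʳ (at x D) (∈-++⁺ʳ (at y pX) (∈-++⁺ʳ (at x pY) (∈-at x a∈))))

    -- A color common to `q`, `v`, `w` is not shared by `u`, so it lies in `only u v w`, and outside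
    -- `p` by `offp`. At most r - 3 colors remain, against `blocked₃`.
    outside-two : ∀ {u v w p} → cls q ≢ cls v → cls q ≢ cls w → cls v ≢ cls w →
      (∀ {a} → name a u ≡ name a v → name a v ≡ name a w → name a q ≢ name a v) →
      Off q v p → ∣ only u v w ─ p ∣ ≤ suc s → ⊥
    outside-two {u} {v} {w} {p} q≢v q≢w v≢w no-common offp rest =
      blocked₃ q≢v q≢w v≢w (only u v w ─ p)
        (λ a∈ → let v≡q , w≡q = ∈-filterₛ⁻ (agree₃? q v w) a∈
                    v≡w = trans v≡q (sym w≡q)
                in x∈p∧x∉q⇒x∈p─q
                     (∈-filterₛ⁺ (only? u v w) (v≡w , λ u≡v → no-common u≡v v≡w (sym v≡q)))
                     (λ a∈p → offp a∈p (sym v≡q)))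
        (≤-trans (+-monoˡ-≤ 3 rest) (≤-reflexive (trans (+-comm (suc s) 3) (sym r≡4+s))))

    common : ∀ {a} → name a x ≡ name a y → name a x ≡ name a z → name a q ≢ name a x
    common x≡y x≡z = offD (∈-filterₛ⁺ (agree₃? x y z) (sym x≡y , sym x≡z))

    refuted : ⊥
    refuted with cls q ≟ cls x | cls q ≟ cls y
    -- The class of `q` differs from those of two among `x`, `y`, `z`; the remaining vertex plays
    -- `u`.
    ... | yes q≡x | _ = outside-two {x} {y} {z} {pX}
      (λ q≡y → x≢y (trans (sym q≡x) q≡y)) (λ q≡z → x≢z (trans (sym q≡x) q≡z)) y≢z
      (λ x≡y y≡z q≡y → common x≡y (trans x≡y y≡z) (trans q≡y (sym x≡y))) offX restX
    ... | no q≢x | yes q≡y = outside-two {y} {x} {z} {pY}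
      q≢x (λ q≡z → y≢z (trans (sym q≡y) q≡z)) x≢z
      (λ y≡x x≡z → common (sym y≡x) x≡z) offY restY
    ... | no q≢x | no q≢y = outside-two {z} {x} {y} {pZ}
      q≢x q≢y x≢y (λ z≡x x≡y → common x≡y (sym z≡x)) offZ restZ

-- The case r = 3, by certified search

-- A value `y` not attained, put in front of the values of `f`, would give n + 1 distinct elements
-- of `Fin n`.
injective⇒permutation : ∀ {n} (f : Fin n → Fin n) → (∀ {x y} → f x ≡ f y → x ≡ y) →
  ∃ λ (π : Permutation′ n) → ∀ x → π ⟨$⟩ʳ x ≡ f x
injective⇒permutation {n} f f-inj =
  permutation f (proj₁ ∘ onto) (proj₂ ∘ onto) (λ x → f-inj (proj₂ (onto (f x)))) , λ _ → refl
  where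
  onto : ∀ y → ∃ λ x → f x ≡ y
  onto y with any? (λ x → f x ≟ y)
  ... | yes hit = hit
  ... | no miss with pigeonhole ≤-refl (λ { zero → y ; (suc x) → f x })
  ...   | zero  , suc j , _   , eq = contradiction (j , sym eq) miss
  ...   | suc i , suc j , i<j , eq = contradiction (cong toℕ (f-inj eq)) (<⇒≢ (≤-pred i<j))

-- The requirements on a system are invariant under permuting classes and colors, so a triple may be
-- brought into a standard position.
relabel : ∀ {r k} → Permutation′ r → Permutation′ k → System r k → System r k
relabel {r} {k} γ σ S = record
  { V         = V
  ; cls       = λ v → γ ⟨$⟩ˡ cls v
  ; name      = λ a → name (σ ⟨$⟩ʳ a)
  ; inhabited = λ j → let v , v∈ = inhabited (γ ⟨$⟩ʳ j) in v , back v∈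
  ; mono      = λ e e∈ →
      let a , same = mono (λ j → e (γ ⟨$⟩ˡ j)) (λ j → forth (e∈ (γ ⟨$⟩ˡ j)))
      in σ ⟨$⟩ˡ a , λ i j → subst (λ a → name a (e i) ≡ name a (e j)) (sym (inverseʳ σ))
        (subst₂ (λ i j → name a (e i) ≡ name a (e j)) (inverseˡ γ) (inverseˡ γ)
          (same (γ ⟨$⟩ʳ i) (γ ⟨$⟩ʳ j)))
  ; avoid     = λ u a j j≢ →
      let w , w∈ , w≁u = avoid u (σ ⟨$⟩ʳ a) (γ ⟨$⟩ʳ j)
            (λ eq → j≢ (trans (sym (inverseˡ γ)) (cong (γ ⟨$⟩ˡ_) eq)))
      in w , back w∈ , w≁u
  ; uncovered = λ L short →
      let q , off = uncovered (map (λ (a , n) → σ ⟨$⟩ʳ a , n) L)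
            (≤-trans (≤-reflexive (length-map _ L)) short)
      in q , All.map⁻ off
  }
  where
  open System S
  back : ∀ {j c} → c ≡ γ ⟨$⟩ʳ j → γ ⟨$⟩ˡ c ≡ j
  back refl = inverseˡ γ
  forth : ∀ {c j} → γ ⟨$⟩ˡ c ≡ γ ⟨$⟩ˡ j → c ≡ j
  forth eq = trans (sym (inverseʳ γ)) (trans (cong (γ ⟨$⟩ʳ_) eq) (inverseʳ γ))

-- A code lists, for each color, an index for the component of a vertex.
Code : Set
Code = Vec ℕ 5

Row : Set
Row = Fin 3 × Code

Cover : Set
Cover = List (Fin 5 × ℕ)

-- `cover cov ts` covers by the components `cov`; the trees in ts refute, in the
-- order of `candidates`, all rows that an uncovered vertex can have.
data Tree : Set where
  cover : Cover → List Tree → Tree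

common : Code → Code → Subset 5
common = zipWith ℕ._≡ᵇ_

-- For r = 3 the bounds 2 here and 1 in `Compatible₃` are the r - 1 and r - 2 of `blocked₂` and
-- `blocked₃`.
Compatible₂ : Row → Row → Set
Compatible₂ (c , m) (d , n) = c ≡ d ⊎ 2 ≤ ∣ common m n ∣

Compatible₃ : Row → Row → Row → Set
Compatible₃ (c , m) (d , n) (e , o) =
  c ≡ d ⊎ c ≡ e ⊎ d ≡ e ⊎ 1 ≤ ∣ common m n ∩ common m o ∣

Compatible : List Row → Row → Set
Compatible st q = All (Compatible₂ q) st × All (λ s → All (Compatible₃ q s) st) st

compatible₂? : ∀ q s → Dec (Compatible₂ q s)
compatible₂? (c , m) (d , n) = c ≟ d ⊎-dec 2 ℕ.≤? ∣ common m n ∣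

compatible₃? : ∀ q s t → Dec (Compatible₃ q s t)
compatible₃? (c , m) (d , n) (e , o) =
  c ≟ d ⊎-dec c ≟ e ⊎-dec d ≟ e ⊎-dec 1 ℕ.≤? ∣ common m n ∩ common m o ∣

compatible? : ∀ st → Decidable (Compatible st)
compatible? st q = All.all? (compatible₂? q) st ×-dec
  All.all? (λ s → All.all? (compatible₃? q s) st) st

product : ∀ {n} {A : Set} → Vec (List A) n → List (Vec A n)
product []         = [] ∷ []
product (xs ∷ xss) = cartesianProductWith _∷_ xs (product xss)

∈-product : ∀ {n} {A : Set} (xss : Vec (List A) n) {v : Vec A n} →
  (∀ i → v ! i ∈ xss ! i) → v ∈ product xss
∈-product []         {[]}    _ = here refl
∈-product (xs ∷ xss) {x ∷ v} p =
  ∈-cartesianProductWith⁺ _∷_ (p zero) (∈-product xss (p ∘ suc))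

open DecMembership (Product.≡-dec (_≟_ {5}) ℕ._≟_) using () renaming (_∈?_ to _∈ₗ?_)

-- An uncovered vertex lies in a known component (index below the bound) or in a
-- new one (index equal to the bound).
option : Cover → Code → Fin 5 → List ℕ
option cov bnd a = filter (λ m → ¬? ((a , m) ∈ₗ? cov)) (upTo (suc (bnd ! a)))

options : Cover → Code → Vec (List ℕ) 5
options cov bnd = tabulate (option cov bnd)

candidates : Cover → Code → List Row → List Row
candidates cov bnd st = filter (compatible? st) (cartesianProduct (allFin 3) (product (options cov bnd)))

-- The bound counts the components of a color that have an index; an index equal to it introduces
-- the next one.
grow : Code → Code → Code
grow = zipWith λ b m → b ℕ.⊔ suc m

legal? : (cov : Cover) (bnd : Code) → Dec (length cov ≤ 3 × All (λ (a , m) → m ℕ.< bnd ! a) cov)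
legal? cov bnd = length cov ℕ.≤? 3 ×-dec All.all? (λ (a , m) → m ℕ.<? bnd ! a) cov

mutual
  refutes : Tree → Code → List Row → Bool
  refutes (cover cov ts) bnd st = ⌊ legal? cov bnd ⌋ ∧ refuteAll ts bnd st (candidates cov bnd st)

  refuteAll : List Tree → Code → List Row → List Row → Bool
  refuteAll _        bnd st []       = true
  refuteAll []       bnd st (q ∷ qs) = false
  refuteAll (t ∷ ts) bnd st (q ∷ qs) = refutes t (grow bnd (proj₂ q)) (q ∷ st) ∧ refuteAll ts bnd st qs

-- Soundness of the search

module Soundness (S : System 3 5) where
  open System S
  open Blocking S

  Reads : (Fin 5 → ℕ → ℕ) → V → Code → Set
  Reads ρ v m = ∀ a → name a v ≡ ρ a (m ! a)

  -- Realizes the rows by vertices of the system: `ρ a m` names the component with index `m` in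
  -- color `a`, and below the bound different indices stand for different components.
  record Model (bnd : Code) (st : List Row) : Set where
    field
      ρ    : Fin 5 → ℕ → ℕ
      inj  : ∀ a {m n} → m ℕ.< bnd ! a → n ℕ.< bnd ! a → ρ a m ≡ ρ a n → m ≡ n
      rows : All (λ (c , m) → ∃ λ v → cls v ≡ c × (∀ a → m ! a ℕ.< bnd ! a) × Reads ρ v m) st

  InjectiveBelow : ℕ → (ℕ → ℕ) → Set
  InjectiveBelow b f = ∀ {m n} → m ℕ.< b → n ℕ.< b → f m ≡ f n → m ≡ n

  -- A component already indexed keeps its index; otherwise `n` becomes the value at the next free
  -- index `b`, and injectivity extends because `n` is new.
  locate : ∀ b f → InjectiveBelow b f → ∀ n → ∃₂ λ m g →
    m ≤ b × (∀ {i} → i ℕ.< b → g i ≡ f i) × g m ≡ n × InjectiveBelow (b ℕ.⊔ suc m) g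
  locate b f f-inj n with any? (λ (i : Fin b) → f (toℕ i) ℕ.≟ n)
  ... | yes (i , hit) = toℕ i , f , <⇒≤ (toℕ<n i) , (λ _ → refl) , hit ,
    subst (λ b → InjectiveBelow b f) (sym (m≥n⇒m⊔n≡m (toℕ<n i))) f-inj
  ... | no miss = b , g , ≤-refl , g-old , g-new ,
    subst (λ b → InjectiveBelow b g) (sym (m≤n⇒m⊔n≡n (n≤1+n b))) g-inj
    where
    g : ℕ → ℕ
    g i with i ℕ.≟ b
    ... | yes _ = n
    ... | no _  = f i
    g-new : g b ≡ n
    g-new with b ℕ.≟ b
    ... | yes _ = refl
    ... | no ≢  = contradiction refl ≢
    g-old : ∀ {i} → i ℕ.< b → g i ≡ f i
    g-old {i} i<b with i ℕ.≟ b
    ... | yes refl = contradiction i<b (<-irrefl refl)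
    ... | no _     = refl
    fresh : ∀ {i} → i ℕ.< b → f i ≢ n
    fresh i<b eq = miss (fromℕ< i<b , trans (cong f (toℕ-fromℕ< i<b)) eq)
    below : ∀ {i} → i ℕ.< suc b → i ≢ b → i ℕ.< b
    below i<1+b i≢b = ≤∧≢⇒< (≤-pred i<1+b) i≢b
    g-inj : InjectiveBelow (suc b) g
    g-inj {i} {j} i< j< eq with i ℕ.≟ b | j ℕ.≟ b
    ... | yes i≡b | yes j≡b = trans i≡b (sym j≡b)
    ... | yes _   | no j≢b  = contradiction (sym eq) (fresh (below j< j≢b))
    ... | no i≢b  | yes _   = contradiction eq (fresh (below i< i≢b))
    ... | no i≢b  | no j≢b  = f-inj (below i< i≢b) (below j< j≢b) eq

  module _ {bnd st} (M : Model bnd st) (q : V) where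
    open Model M

    private
      at-color : ∀ a → _
      at-color a = locate (bnd ! a) (ρ a) (inj a) (name a q)

    code : Code
    code = tabulate (proj₁ ∘ at-color)

    code-! : ∀ a → code ! a ≡ proj₁ (at-color a)
    code-! = lookup∘tabulate (proj₁ ∘ at-color)

    ρ′ : Fin 5 → ℕ → ℕ
    ρ′ a = proj₁ (proj₂ (at-color a))

    code≤bnd : ∀ a → code ! a ≤ bnd ! a
    code≤bnd a rewrite code-! a = proj₁ (proj₂ (proj₂ (at-color a)))

    ρ′-old : ∀ a {m} → m ℕ.< bnd ! a → ρ′ a m ≡ ρ a m
    ρ′-old a = proj₁ (proj₂ (proj₂ (proj₂ (at-color a))))

    reads-new : Reads ρ′ q code
    reads-new a rewrite code-! a = sym (proj₁ (proj₂ (proj₂ (proj₂ (proj₂ (at-color a))))))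

    bnd-grow : ∀ a → grow bnd code ! a ≡ bnd ! a ℕ.⊔ suc (code ! a)
    bnd-grow a = lookup-zipWith _ a bnd code

    -- Earlier rows stay valid as `ρ′` agrees with `ρ` below the old bound.
    extend : Model (grow bnd code) ((cls q , code) ∷ st)
    extend = record
      { ρ    = ρ′
      ; inj  = λ a → subst (λ b → InjectiveBelow b (ρ′ a))
          (sym (trans (bnd-grow a) (cong (λ m → bnd ! a ℕ.⊔ suc m) (code-! a))))
          (proj₂ (proj₂ (proj₂ (proj₂ (proj₂ (at-color a))))))
      ; rows =
          (q , refl , (λ a → ≤-trans (m≤n⊔m (bnd ! a) _) (≤-reflexive (sym (bnd-grow a)))) , reads-new)
          ∷ All.map (λ (v , v∈ , low , reads) →
              v , v∈ ,
              (λ a → <-≤-trans (low a) (≤-trans (m≤m⊔n (bnd ! a) _) (≤-reflexive (sym (bnd-grow a))))) ,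
              λ a → trans (reads a) (sym (ρ′-old a (low a)))) rows
      }

  -- Both indices lie below the bound, where `ρ` is injective, so equal components carry equal
  -- indices.
  ∈-common : ∀ {bnd st} (M : Model bnd st) {u v m n} →
    Reads (Model.ρ M) u m → Reads (Model.ρ M) v n → (∀ a → m ! a ℕ.< bnd ! a) → (∀ a → n ! a ℕ.< bnd ! a) →
    ∀ {a} → name a v ≡ name a u → a ∈ₛ common m n
  ∈-common M {m = m} {n} u-reads v-reads m< n< {a} eq = lookup⇒[]= a (common m n) (begin
    common m n ! a          ≡⟨ lookup-zipWith ℕ._≡ᵇ_ a m n ⟩
    (m ! a) ℕ.≡ᵇ (n ! a)    ≡⟨ dec-true ((m ! a) ℕ.≟ (n ! a)) (Model.inj M a (m< a) (n< a)
                                 (trans (sym (u-reads a)) (trans (sym eq) (v-reads a)))) ⟩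
    true                    ∎)
    where open ≡-Reasoning

  -- The colors where the codes agree contain all those where the vertices agree; were they too few,
  -- `blocked₂` or `blocked₃` would apply.
  compatible : ∀ {bnd q st} → Model bnd (q ∷ st) → Compatible st q
  compatible {bnd} {c , m} {st} M with Model.rows M
  ... | (u , refl , u-low , u-reads) ∷ rows = All.map two rows , All.map (λ s → All.map (three s) rows) rows
    where
    open Model M using (ρ)
    Sat : Row → Set
    Sat (c , m) = ∃ λ v → cls v ≡ c × (∀ a → m ! a ℕ.< bnd ! a) × Reads ρ v m
    two : ∀ {s} → Sat s → Compatible₂ (cls u , m) s
    two {d , n} (v , refl , v-low , v-reads) with cls u ≟ cls v
    ... | yes eq = inj₁ eq
    ... | no u≢v = inj₂ (≰⇒> λ few → blocked₂ u≢v (common m n)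
      (λ a∈ → ∈-common M u-reads v-reads u-low v-low (∈-filterₛ⁻ (agree? u v) a∈)) (+-monoˡ-≤ 2 few))
    three : ∀ {s t} → Sat s → Sat t → Compatible₃ (cls u , m) s t
    three {d , n} {e , o} (v , refl , v-low , v-reads) (w , refl , w-low , w-reads)
      with cls u ≟ cls v | cls u ≟ cls w | cls v ≟ cls w
    ... | yes eq | _      | _      = inj₁ eq
    ... | no _   | yes eq | _      = inj₂ (inj₁ eq)
    ... | no _   | no _   | yes eq = inj₂ (inj₂ (inj₁ eq))
    ... | no u≢v | no u≢w | no v≢w = inj₂ (inj₂ (inj₂ (≰⇒> λ few →
      blocked₃ u≢v u≢w v≢w (common m n ∩ common m o)
        (λ a∈ → let v∼u , w∼u = ∈-filterₛ⁻ (agree₃? u v w) a∈ in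
          x∈p∩q⁺ (∈-common M u-reads v-reads u-low v-low v∼u , ∈-common M u-reads w-reads u-low w-low w∼u))
        (+-monoˡ-≤ 3 few))))

  module _ where
    open Equivalence

    mutual
      -- Some vertex escapes the cover; its row passes both filters defining `candidates`, so the
      -- subtree for that row refutes the model extended by it.
      sound : ∀ t {bnd st} → T (refutes t bnd st) → Model bnd st → ⊥
      sound (cover cov ts) {bnd} {st} ok M =
        let legal , rest = to (T-∧ {⌊ legal? cov bnd ⌋}) ok
            short , low = toWitness {a? = legal? cov bnd} legal
            q , off = uncovered (map (λ (a , m) → a , Model.ρ M a m) cov)
              (≤-trans (≤-reflexive (length-map _ cov)) short)
            M′ = extend M q
            off′ : ∀ {a m} → (a , m) ∈ cov → name a q ≢ Model.ρ M a m
            off′ am∈ = All.lookup (All.map⁻ off) am∈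
            allowed : ∀ a → code M q ! a ∈ options cov bnd ! a
            allowed a = subst (code M q ! a ∈_) (sym (lookup∘tabulate (option cov bnd) a))
              (∈-filter⁺ (λ m → ¬? ((a , m) ∈ₗ? cov)) (∈-upTo⁺ (s≤s (code≤bnd M q a))) λ am∈ →
                off′ am∈ (trans (reads-new M q a) (ρ′-old M q a (All.lookup low am∈))))
        in soundAll ts rest M q (∈-filter⁺ (compatible? st)
             (∈-cartesianProduct⁺ (∈-allFin (cls q)) (∈-product (options cov bnd) allowed))
             (compatible M′))

      soundAll : ∀ ts {bnd st qs} → T (refuteAll ts bnd st qs) → (M : Model bnd st) (q : V) →
        (cls q , code M q) ∈ qs → ⊥
      soundAll (t ∷ ts) {bnd} {st} ok M q (here refl) =
        sound t (proj₁ (to (T-∧ {refutes t (grow bnd (code M q)) ((cls q , code M q) ∷ st)}) ok)) (extend M q)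
      soundAll (t ∷ ts) {bnd} {st} {q′ ∷ _} ok M q (there q∈) =
        soundAll ts (proj₂ (to (T-∧ {refutes t (grow bnd (proj₂ q′)) (q′ ∷ st)}) ok)) M q q∈

-- The two trees were found by computer search.
distinct : Tree
distinct =
  cover ((0F , 0) ∷ (1F , 0) ∷ (1F , 1) ∷ [])
    ( cover ((0F , 0) ∷ (2F , 0) ∷ (3F , 1) ∷ [])
      ( cover ((0F , 0) ∷ (0F , 1) ∷ (1F , 0) ∷ [])
        ( cover ((0F , 0) ∷ (3F , 1) ∷ (4F , 1) ∷ []) []
        ∷ cover ((0F , 0) ∷ (2F , 0) ∷ (4F , 1) ∷ []) []
        ∷ [])
      ∷ cover ((0F , 0) ∷ (0F , 1) ∷ (1F , 0) ∷ [])
        ( cover ((0F , 0) ∷ (1F , 0) ∷ (4F , 1) ∷ []) []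
        ∷ cover ((0F , 0) ∷ (2F , 0) ∷ (4F , 1) ∷ []) []
        ∷ [])
      ∷ [])
    ∷ cover ((0F , 0) ∷ (0F , 1) ∷ (3F , 1) ∷ [])
      ( cover ((0F , 0) ∷ (2F , 0) ∷ (4F , 2) ∷ []) []
      ∷ cover ((0F , 0) ∷ (3F , 0) ∷ (3F , 1) ∷ [])
        ( cover ((0F , 0) ∷ (1F , 0) ∷ (4F , 2) ∷ []) []
        ∷ cover ((0F , 0) ∷ (1F , 0) ∷ (2F , 1) ∷ []) []
        ∷ [])
      ∷ [])
    ∷ cover ((0F , 0) ∷ (0F , 1) ∷ (2F , 0) ∷ [])
      ( cover ((0F , 0) ∷ (2F , 0) ∷ (4F , 2) ∷ []) []
      ∷ cover ((0F , 0) ∷ (2F , 0) ∷ (2F , 1) ∷ [])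
        ( cover ((0F , 0) ∷ (1F , 0) ∷ (4F , 2) ∷ []) []
        ∷ cover ((0F , 0) ∷ (1F , 0) ∷ (2F , 0) ∷ []) []
        ∷ [])
      ∷ [])
    ∷ cover ((0F , 0) ∷ (2F , 0) ∷ (3F , 1) ∷ [])
      ( cover ((0F , 0) ∷ (0F , 1) ∷ (1F , 0) ∷ [])
        ( cover ((0F , 0) ∷ (3F , 1) ∷ (4F , 0) ∷ []) []
        ∷ cover ((0F , 0) ∷ (2F , 0) ∷ (4F , 0) ∷ []) []
        ∷ [])
      ∷ cover ((0F , 0) ∷ (0F , 1) ∷ (1F , 0) ∷ [])
        ( cover ((0F , 0) ∷ (3F , 1) ∷ (4F , 0) ∷ []) []
        ∷ cover ((0F , 0) ∷ (1F , 0) ∷ (4F , 0) ∷ []) []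
        ∷ [])
      ∷ [])
    ∷ [])

doubled : Tree
doubled =
  cover ((0F , 0) ∷ (1F , 0) ∷ (1F , 1) ∷ [])
    ( cover ((0F , 0) ∷ (3F , 1) ∷ (4F , 1) ∷ [])
      ( cover ((0F , 0) ∷ (0F , 1) ∷ (2F , 0) ∷ [])
        ( cover ((1F , 1) ∷ (2F , 0) ∷ (4F , 1) ∷ []) []
        ∷ cover ((1F , 1) ∷ (2F , 0) ∷ (3F , 1) ∷ []) []
        ∷ [])
      ∷ cover ((0F , 0) ∷ (0F , 1) ∷ (2F , 0) ∷ [])
        ( cover ((1F , 1) ∷ (2F , 0) ∷ (4F , 1) ∷ []) []
        ∷ cover ((0F , 0) ∷ (1F , 1) ∷ (2F , 0) ∷ []) []
        ∷ [])
      ∷ cover ((0F , 0) ∷ (0F , 1) ∷ (2F , 0) ∷ [])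
        ( cover ((1F , 1) ∷ (2F , 0) ∷ (3F , 1) ∷ []) []
        ∷ cover ((0F , 0) ∷ (1F , 1) ∷ (2F , 0) ∷ []) []
        ∷ [])
      ∷ [])
    ∷ cover ((0F , 0) ∷ (3F , 1) ∷ (4F , 1) ∷ [])
      ( cover ((0F , 0) ∷ (0F , 1) ∷ (1F , 0) ∷ [])
        ( cover ((1F , 0) ∷ (2F , 1) ∷ (4F , 1) ∷ []) []
        ∷ cover ((1F , 0) ∷ (2F , 1) ∷ (3F , 1) ∷ []) []
        ∷ [])
      ∷ cover ((0F , 0) ∷ (0F , 1) ∷ (1F , 0) ∷ [])
        ( cover ((1F , 0) ∷ (2F , 1) ∷ (4F , 1) ∷ []) []
        ∷ cover ((0F , 0) ∷ (1F , 0) ∷ (2F , 1) ∷ []) []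
        ∷ [])
      ∷ cover ((0F , 0) ∷ (0F , 1) ∷ (1F , 0) ∷ [])
        ( cover ((1F , 0) ∷ (2F , 1) ∷ (3F , 1) ∷ []) []
        ∷ cover ((0F , 0) ∷ (1F , 0) ∷ (2F , 1) ∷ []) []
        ∷ [])
      ∷ [])
    ∷ cover ((0F , 0) ∷ (3F , 1) ∷ (4F , 1) ∷ []) []
    ∷ cover ((0F , 0) ∷ (2F , 0) ∷ (4F , 1) ∷ [])
      ( cover ((0F , 0) ∷ (0F , 1) ∷ (4F , 1) ∷ [])
        ( cover ((0F , 0) ∷ (1F , 0) ∷ (2F , 0) ∷ []) []
        ∷ cover ((0F , 0) ∷ (2F , 0) ∷ (3F , 0) ∷ []) []
        ∷ [])
      ∷ cover ((3F , 0) ∷ (3F , 1) ∷ (4F , 1) ∷ [])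
        ( cover ((0F , 0) ∷ (0F , 1) ∷ (2F , 0) ∷ []) []
        ∷ [])
      ∷ [])
    ∷ cover ((0F , 0) ∷ (2F , 0) ∷ (3F , 1) ∷ [])
      ( cover ((0F , 0) ∷ (0F , 1) ∷ (3F , 1) ∷ [])
        ( cover ((0F , 0) ∷ (1F , 0) ∷ (2F , 0) ∷ []) []
        ∷ cover ((0F , 0) ∷ (2F , 0) ∷ (4F , 0) ∷ []) []
        ∷ [])
      ∷ cover ((3F , 1) ∷ (4F , 0) ∷ (4F , 1) ∷ [])
        ( cover ((0F , 0) ∷ (0F , 1) ∷ (2F , 0) ∷ []) []
        ∷ [])
      ∷ [])
    ∷ [])

distinct-bound doubled-bound : Code
distinct-bound = 1 ∷ 2 ∷ 2 ∷ 2 ∷ 3 ∷ []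
doubled-bound  = 1 ∷ 2 ∷ 2 ∷ 2 ∷ 2 ∷ []

-- Color 0 is common to all three vertices, colors 1, 2, 3 are shared by one pair each, and color 4
-- by no pair or by the last two vertices.
distinct-start doubled-start : List Row
distinct-start =
  (0F , 0 ∷ 0 ∷ 0 ∷ 0 ∷ 0 ∷ []) ∷ (1F , 0 ∷ 0 ∷ 1 ∷ 1 ∷ 1 ∷ []) ∷ (2F , 0 ∷ 1 ∷ 0 ∷ 1 ∷ 2 ∷ []) ∷ []
doubled-start =
  (0F , 0 ∷ 0 ∷ 0 ∷ 0 ∷ 0 ∷ []) ∷ (1F , 0 ∷ 0 ∷ 1 ∷ 1 ∷ 1 ∷ []) ∷ (2F , 0 ∷ 1 ∷ 0 ∷ 1 ∷ 1 ∷ []) ∷ []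

-- The two patterns and their refutation

module _ (S : System 3 5) where
  open System S

  -- Standard position of a triple from the three classes; `Last` records how the fifth color
  -- behaves on it.
  record Pattern (Last : V → V → V → Set) : Set where
    field
      u v w : V
      u∈    : cls u ≡ 0F
      v∈    : cls v ≡ 1F
      w∈    : cls w ≡ 2F
      all   : name 0F v ≡ name 0F u × name 0F w ≡ name 0F u
      uv    : name 1F v ≡ name 1F u × name 1F w ≢ name 1F u
      uw    : name 2F w ≡ name 2F u × name 2F v ≢ name 2F u
      vw    : name 3F w ≡ name 3F v × name 3F v ≢ name 3F u
      last  : Last u v w

  Doubled Distinct : V → V → V → Set
  Doubled u v w  = name 4F w ≡ name 4F v × name 4F v ≢ name 4F u
  Distinct u v w = name 4F w ≢ name 4F v × name 4F w ≢ name 4F u × name 4F v ≢ name 4F u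

  open Soundness S

  private
    two-values : ∀ {f : ℕ → ℕ} → f 1 ≢ f 0 → InjectiveBelow 2 f
    two-values ≢ {0} {0} _ _ _  = refl
    two-values ≢ {0} {1} _ _ eq = contradiction (sym eq) ≢
    two-values ≢ {1} {0} _ _ eq = contradiction eq ≢
    two-values ≢ {1} {1} _ _ _  = refl
    two-values ≢ {suc (suc _)} (s≤s (s≤s ()))
    two-values ≢ {0} {suc (suc _)} _ (s≤s (s≤s ()))
    two-values ≢ {1} {suc (suc _)} _ (s≤s (s≤s ()))

    three-values : ∀ {f : ℕ → ℕ} → f 2 ≢ f 1 → f 2 ≢ f 0 → f 1 ≢ f 0 → InjectiveBelow 3 f
    three-values 2≢1 2≢0 1≢0 {0} {0} _ _ eq = refl
    three-values 2≢1 2≢0 1≢0 {0} {1} _ _ eq = contradiction (sym eq) 1≢0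
    three-values 2≢1 2≢0 1≢0 {0} {2} _ _ eq = contradiction (sym eq) 2≢0
    three-values 2≢1 2≢0 1≢0 {1} {0} _ _ eq = contradiction eq 1≢0
    three-values 2≢1 2≢0 1≢0 {1} {1} _ _ eq = refl
    three-values 2≢1 2≢0 1≢0 {1} {2} _ _ eq = contradiction (sym eq) 2≢1
    three-values 2≢1 2≢0 1≢0 {2} {0} _ _ eq = contradiction eq 2≢0
    three-values 2≢1 2≢0 1≢0 {2} {1} _ _ eq = contradiction eq 2≢1
    three-values 2≢1 2≢0 1≢0 {2} {2} _ _ eq = refl
    three-values _ _ _ {suc (suc (suc _))} (s≤s (s≤s (s≤s ())))
    three-values _ _ _ {0} {suc (suc (suc _))} _ (s≤s (s≤s (s≤s ())))
    three-values _ _ _ {1} {suc (suc (suc _))} _ (s≤s (s≤s (s≤s ())))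
    three-values _ _ _ {2} {suc (suc (suc _))} _ (s≤s (s≤s (s≤s ())))

  no-doubled : Pattern Doubled → ⊥
  -- Here `tt` is accepted since `refutes` evaluates to `true` on the tree, so type checking runs
  -- the search.
  no-doubled P = sound doubled {doubled-bound} {doubled-start} tt record
    { ρ    = λ a m → name a (rep a m)
    ; inj  = λ { 0F {zero} {zero} _ _ _ → refl
               ; 0F {suc _} (s≤s ())
               ; 0F {zero} {suc _} _ (s≤s ())
               ; 1F → two-values (proj₂ uv)
               ; 2F → two-values (proj₂ uw)
               ; 3F → two-values (proj₂ vw)
               ; 4F → two-values (proj₂ last) }
    ; rows =
        (u , u∈ , (λ { 0F → s≤s z≤n ; 1F → s≤s z≤n ; 2F → s≤s z≤n ; 3F → s≤s z≤n ; 4F → s≤s z≤n }) ,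
          λ { 0F → refl ; 1F → refl ; 2F → refl ; 3F → refl ; 4F → refl })
      ∷ (v , v∈ , (λ { 0F → s≤s z≤n ; 1F → s≤s z≤n ; 2F → s≤s (s≤s z≤n) ; 3F → s≤s (s≤s z≤n) ; 4F → s≤s (s≤s z≤n) }) ,
          λ { 0F → proj₁ all ; 1F → proj₁ uv ; 2F → refl ; 3F → refl ; 4F → refl })
      ∷ (w , w∈ , (λ { 0F → s≤s z≤n ; 1F → s≤s (s≤s z≤n) ; 2F → s≤s z≤n ; 3F → s≤s (s≤s z≤n) ; 4F → s≤s (s≤s z≤n) }) ,
          λ { 0F → proj₂ all ; 1F → refl ; 2F → proj₁ uw ; 3F → proj₁ vw ; 4F → proj₁ last })
      ∷ []
    }
    where
    open Pattern P
    -- Below the bound, a vertex whose code has the given index in the given color. In color 1 the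
    -- index 1 belongs to `w`, as `v` has index 0 there.
    rep : Fin 5 → ℕ → V
    rep 0F _       = u
    rep 1F zero    = u
    rep 1F (suc _) = w
    rep _  zero    = u
    rep _  (suc _) = v

  no-distinct : Pattern Distinct → ⊥
  no-distinct P = sound distinct {distinct-bound} {distinct-start} tt record
    { ρ    = λ a m → name a (rep a m)
    ; inj  = λ { 0F {zero} {zero} _ _ _ → refl
               ; 0F {suc _} (s≤s ())
               ; 0F {zero} {suc _} _ (s≤s ())
               ; 1F → two-values (proj₂ uv)
               ; 2F → two-values (proj₂ uw)
               ; 3F → two-values (proj₂ vw)
               ; 4F → three-values (proj₁ last) (proj₁ (proj₂ last)) (proj₂ (proj₂ last)) }
    ; rows =
        (u , u∈ , (λ { 0F → s≤s z≤n ; 1F → s≤s z≤n ; 2F → s≤s z≤n ; 3F → s≤s z≤n ; 4F → s≤s z≤n }) ,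
          λ { 0F → refl ; 1F → refl ; 2F → refl ; 3F → refl ; 4F → refl })
      ∷ (v , v∈ , (λ { 0F → s≤s z≤n ; 1F → s≤s z≤n ; 2F → s≤s (s≤s z≤n) ; 3F → s≤s (s≤s z≤n) ; 4F → s≤s (s≤s z≤n) }) ,
          λ { 0F → proj₁ all ; 1F → proj₁ uv ; 2F → refl ; 3F → refl ; 4F → refl })
      ∷ (w , w∈ , (λ { 0F → s≤s z≤n ; 1F → s≤s (s≤s z≤n) ; 2F → s≤s z≤n ; 3F → s≤s (s≤s z≤n) ; 4F → s≤s (s≤s (s≤s z≤n)) }) ,
          λ { 0F → proj₂ all ; 1F → refl ; 2F → proj₁ uw ; 3F → proj₁ vw ; 4F → refl })
      ∷ []
    }
    where
    open Pattern P
    -- In color 4 the three vertices have different components, the third being that of `w`.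
    rep : Fin 5 → ℕ → V
    rep 0F _             = u
    rep 1F zero          = u
    rep 1F (suc _)       = w
    rep 4F (suc (suc _)) = w
    rep _  zero          = u
    rep _  (suc _)       = v

-- Reduction of tight triples to the patterns

module _ (S : System 3 5) where
  open System S

  -- The colors `d`, `c₁`, `c₂`, `c₃` are told apart by the pairs agreeing in them, and `f` differs
  -- from them by assumption; so permutations of classes and colors give the standard position.
  no-triple : ∀ {u v w} → cls u ≢ cls v → cls u ≢ cls w → cls v ≢ cls w →
    ∀ d {c₁ c₂ c₃ f} →
    name d v ≡ name d u × name d w ≡ name d u →
    name c₁ v ≡ name c₁ u × name c₁ w ≢ name c₁ u →
    name c₂ w ≡ name c₂ u × name c₂ v ≢ name c₂ u →
    name c₃ w ≡ name c₃ v × name c₃ v ≢ name c₃ u →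
    All (f ≢_) (d ∷ c₁ ∷ c₂ ∷ c₃ ∷ []) →
    name f w ≡ name f v × name f v ≢ name f u ⊎
    name f w ≢ name f v × name f w ≢ name f u × name f v ≢ name f u → ⊥
  no-triple {u} {v} {w} u≢v u≢w v≢w d {c₁} {c₂} {c₃} {f} all uv uw vw (f≢d ∷ f≢1 ∷ f≢2 ∷ f≢3 ∷ []) =
    λ { (inj₁ last) → no-doubled S′ (pattern′ last)
      ; (inj₂ last) → no-distinct S′ (pattern′ last) }
    where
    colors : Vec (Fin 5) 5
    colors = d ∷ c₁ ∷ c₂ ∷ c₃ ∷ f ∷ []
    colors-unique : Unique colors
    colors-unique =
        ((λ { refl → proj₂ uv (proj₂ all) }) ∷ (λ { refl → proj₂ uw (proj₁ all) }) ∷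
         (λ { refl → proj₂ vw (proj₁ all) }) ∷ ≢-sym f≢d ∷ [])
      ∷ ((λ { refl → proj₂ uw (proj₁ uv) }) ∷ (λ { refl → proj₂ vw (proj₁ uv) }) ∷ ≢-sym f≢1 ∷ [])
      ∷ ((λ { refl → proj₂ vw (trans (sym (proj₁ vw)) (proj₁ uw)) }) ∷ ≢-sym f≢2 ∷ [])
      ∷ (≢-sym f≢3 ∷ []) ∷ [] ∷ []
    corners : Vec (Fin 3) 3
    corners = cls u ∷ cls v ∷ cls w ∷ []
    corners-unique : Unique corners
    corners-unique = (u≢v ∷ u≢w ∷ []) ∷ (v≢w ∷ []) ∷ [] ∷ []
    γ,γ≗ = injective⇒permutation (corners !_) (lookup-injective corners-unique _ _)
    σ,σ≗ = injective⇒permutation (colors !_) (lookup-injective colors-unique _ _)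
    γ = proj₁ γ,γ≗
    σ = proj₁ σ,σ≗
    S′ : System 3 5
    S′ = relabel γ σ S
    corner : ∀ i → γ ⟨$⟩ˡ (corners ! i) ≡ i
    corner i = trans (cong (γ ⟨$⟩ˡ_) (sym (proj₂ γ,γ≗ i))) (inverseˡ γ)
    pattern′ : ∀ {Last} → Last u v w → Pattern S′ Last
    pattern′ last = record
      { u = u ; v = v ; w = w ; u∈ = corner 0F ; v∈ = corner 1F ; w∈ = corner 2F
      ; all = all ; uv = uv ; uw = uw ; vw = vw ; last = last }

  -- For r = 3 the set `D` has one color and the three sets `only` are nonempty; picking a color of
  -- each leaves one of the five colors, `f`, which is shared by exactly one pair or by none.
  no-tight : Blocking.Tight S → ⊥
  no-tight t = by-cases (element (≤-reflexive (sym ∣D∣≡1))) (element onlyˣ≥1) (element onlyʸ≥1) (element onlyᶻ≥1)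
    where
    open Blocking S
    open Tight t
    open Profile S ≤-refl t

    element : ∀ {p : Subset 5} → 1 ≤ ∣ p ∣ → ∃ λ a → a ∈ₛ p
    element {p} 1≤ with nonempty? p
    ... | yes a∈  = a∈
    ... | no none = contradiction (≤-trans 1≤ (≤-reflexive (empty⇒∣p∣≡0 none))) λ ()

    ∣D∣≡1 : ∣ D ∣ ≡ 1
    ∣D∣≡1 = +-cancelʳ-≡ 2 ∣ D ∣ 1 ∣D∣≡r∸2

    D-unique : ∀ {a b} → a ∈ₛ D → b ∈ₛ D → b ≡ a
    D-unique {a} {b} a∈ b∈ with b ≟ a
    ... | yes eq = eq
    ... | no b≢a = contradiction
      (<-≤-trans (≤-<-trans z≤n (x∈p⇒∣p-x∣<∣p∣ (x∈p∧x∉q⇒x∈p─q b∈ (b≢a ∘ x∈⁅y⁆⇒x≡y a))))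
        (≤-pred (<-≤-trans (x∈p⇒∣p-x∣<∣p∣ a∈) (≤-reflexive ∣D∣≡1)))) λ ()

    by-cases : (∃ λ a → a ∈ₛ D) → (∃ λ a → a ∈ₛ only x y z) → (∃ λ a → a ∈ₛ only y x z) →
      (∃ λ a → a ∈ₛ only z x y) → ⊥
    by-cases (d , d∈) (cX , X∈) (cY , Y∈) (cZ , Z∈)
      with missed _≟_ (n<1+n 4) (lookup (d ∷ cX ∷ cY ∷ cZ ∷ [])) id id
    ... | f , f-misses with ∈-filterₛ⁻ (agree₃? x y z) d∈ | ∈-filterₛ⁻ (only? x y z) X∈
                          | ∈-filterₛ⁻ (only? y x z) Y∈ | ∈-filterₛ⁻ (only? z x y) Z∈
                          | agree? x y f | agree? x z f | agree? y z f
    ... | y≡x , z≡x | Xyz , Xx | Yxz , Yy | Zxy , Zz | yes f-xy | yes f-xz | _ =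
      f-misses 0F (sym (D-unique d∈ (∈-filterₛ⁺ (agree₃? x y z) (f-xy , f-xz))))
    -- `Doubled` wants the pair sharing `f` as `v`, `w`, so the odd vertex comes first: here `z`, in
    -- the next case `y`.
    ... | y≡x , z≡x | Xyz , Xx | Yxz , Yy | Zxy , Zz | yes f-xy | no f-xz | _ =
      no-triple (≢-sym x≢z) (≢-sym y≢z) x≢y d
        (sym z≡x , trans y≡x (sym z≡x))
        (Yxz , λ eq → Yy (trans eq (sym Yxz)))
        (Xyz , λ eq → Xx (trans eq (sym Xyz)))
        (sym Zxy , ≢-sym Zz)
        (f≢ 0F ∷ f≢ 2F ∷ f≢ 1F ∷ f≢ 3F ∷ [])
        (inj₁ (f-xy , ≢-sym f-xz))
      where
      f≢ : ∀ i → f ≢ lookup (d ∷ cX ∷ cY ∷ cZ ∷ []) i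
      f≢ i = ≢-sym (f-misses i)
    ... | y≡x , z≡x | Xyz , Xx | Yxz , Yy | Zxy , Zz | no f-xy | yes f-xz | _ =
      no-triple (≢-sym x≢y) y≢z x≢z d
        (sym y≡x , trans z≡x (sym y≡x))
        (Zxy , λ eq → Zz (trans eq (sym Zxy)))
        (sym Xyz , Xx)
        (sym Yxz , ≢-sym Yy)
        (f≢ 0F ∷ f≢ 3F ∷ f≢ 1F ∷ f≢ 2F ∷ [])
        (inj₁ (f-xz , ≢-sym f-xy))
      where
      f≢ : ∀ i → f ≢ lookup (d ∷ cX ∷ cY ∷ cZ ∷ []) i
      f≢ i = ≢-sym (f-misses i)
    ... | y≡x , z≡x | Xyz , Xx | Yxz , Yy | Zxy , Zz | no f-xy | no f-xz | f-yz? =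
      no-triple x≢y x≢z y≢z d
        (y≡x , z≡x)
        (sym Zxy , Zz)
        (sym Yxz , Yy)
        (sym Xyz , ≢-sym Xx)
        (f≢ 0F ∷ f≢ 3F ∷ f≢ 2F ∷ f≢ 1F ∷ [])
        (last f-yz?)
      where
      f≢ : ∀ i → f ≢ lookup (d ∷ cX ∷ cY ∷ cZ ∷ []) i
      f≢ i = ≢-sym (f-misses i)
      last : Dec (name f z ≡ name f y) → _
      last (yes f-yz) = inj₁ (f-yz , f-xy)
      last (no f-yz)  = inj₂ (f-yz , f-xz , f-xy)

-- The upper bound

module Joining (H : Hypergraph) where
  open Hypergraph H renaming (_∈_ to _∈ᵉ_)

  joined-sym : ∀ {u v} → Joined u v → Joined v u
  joined-sym (inj₁ eq) = inj₁ (sym eq)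
  joined-sym (inj₂ (e , f , u∈ , v∈ , path)) =
    inj₂ (f , e , v∈ , u∈ , reverse (λ (w , p , q) → w , q , p) path)

  joined-trans : ∀ {u v w} → Joined u v → Joined v w → Joined u w
  joined-trans (inj₁ refl) v∼w         = v∼w
  joined-trans u∼v         (inj₁ refl) = u∼v
  joined-trans {v = v} (inj₂ (e , f , u∈ , v∈ , p)) (inj₂ (g , h , v∈′ , w∈ , q)) =
    inj₂ (e , h , u∈ , w∈ , p ◅◅ (v , v∈ , v∈′) ◅ q)

  same-edge : ∀ {u v} e → u ∈ᵉ e → v ∈ᵉ e → Joined u v
  same-edge e u∈ v∈ = inj₂ (e , e , u∈ , v∈ , ε)

-- Double negation commutes with finite products, so excluded middle may be used for finitely many
-- instances at once.
¬¬-Π : ∀ n {P : Fin n → Set} → (∀ i → ¬ ¬ P i) → ¬ ¬ (∀ i → P i)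
¬¬-Π zero    p k = k λ ()
¬¬-Π (suc n) p k = p zero λ p₀ → ¬¬-Π n (p ∘ suc) λ ps → k λ { zero → p₀ ; (suc i) → ps i }

first : {A : Set} {P : Pred A 0ℓ} → Decidable P → List A → ℕ
first P? []       = 0
first P? (x ∷ xs) with P? x
... | yes _ = 0
... | no _  = suc (first P? xs)

module _ {A : Set} {P Q : Pred A 0ℓ} (P? : Decidable P) (Q? : Decidable Q) where

  first-cong : (∀ {x} → P x → Q x) → (∀ {x} → Q x → P x) → ∀ xs → first P? xs ≡ first Q? xs
  first-cong P⇒Q Q⇒P []       = refl
  first-cong P⇒Q Q⇒P (x ∷ xs) with P? x | Q? x
  ... | yes _ | yes _ = refl
  ... | yes p | no ¬q = contradiction (P⇒Q p) ¬q
  ... | no ¬p | yes q = contradiction (Q⇒P q) ¬p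
  ... | no _  | no _  = cong suc (first-cong P⇒Q Q⇒P xs)

  first-injective : ∀ {xs} → Any P xs → Any Q xs → first P? xs ≡ first Q? xs → ∃ λ x → P x × Q x
  first-injective {x ∷ xs} anyP anyQ eq with P? x | Q? x
  ... | yes p | yes q = x , p , q
  first-injective {x ∷ xs} anyP anyQ () | yes p | no ¬q
  first-injective {x ∷ xs} anyP anyQ () | no ¬p | yes q
  ... | no ¬p | no ¬q = first-injective (Any.tail ¬p anyP) (Any.tail ¬q anyQ) (suc-injective eq)

pad : ∀ {n} {A : Set} → A → List A → Fin n → A
pad d []       i       = d
pad d (x ∷ xs) zero    = x
pad d (x ∷ xs) (suc i) = pad d xs i

∈-pad : ∀ {n} {A : Set} (d : A) {x xs} → x ∈ xs → length xs ≤ n → ∃ λ (i : Fin n) → pad d xs i ≡ x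
∈-pad d (here refl) (s≤s _)  = zero , refl
∈-pad d (there x∈)  (s≤s le) = let i , eq = ∈-pad d x∈ le in suc i , eq

fin : ∀ {n} → NonZero n → Fin n
fin {suc n} _ = zero

-- From a spanning coloring to a system

module Upper {r k : ℕ} (K : CompletePartiteColoring r k) (spanning : CompletePartiteColoring.Spanning K)
  (j₀ : Fin r) where
  open CompletePartiteColoring K hiding (Spanning)
  open ColoredHypergraph coloredHypergraph using (colorClass; CoveredBy; Vertex; Edge)

  private
    module J (a : Fin k) = Hypergraph (colorClass a)
    module JP (a : Fin k) = Joining (colorClass a)

  base : Vertex
  base = j₀ , fin (nonempty j₀)

  vertices : List Vertex
  vertices = concatMap (λ j → map (j ,_) (allFin (size j))) (allFin r)

  ∈-vertices : ∀ v → v ∈ vertices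
  ∈-vertices (j , x) = ∈-concatMap⁺ (λ j → map (j ,_) (allFin (size j)))
    (Any.map (λ { refl → ∈-map⁺ (j ,_) (∈-allFin x) }) (∈-allFin j))

  -- Being joined quantifies over paths of edges. Its decidability is needed only under double
  -- negation, since the final inequality is stable.
  ¬¬-dec : ¬ ¬ (∀ a u v → Dec (J.Joined a u v))
  ¬¬-dec absurd = ¬¬-Π k (λ a → ¬¬-Π r λ i → ¬¬-Π (size i) λ x → ¬¬-Π r λ j → ¬¬-Π (size j) λ y →
    ¬¬-excluded-middle {A = J.Joined a (i , x) (j , y)})
    λ dec → absurd λ a (i , x) (j , y) → dec a i x j y

  module _ (dec : ∀ a u v → Dec (J.Joined a u v)) (uncoverable : ¬ CoveredBy r) where

    -- The position, in the enumeration, of the first vertex of the component.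
    name : Fin k → Vertex → ℕ
    name a v = first (λ u → dec a u v) vertices

    joined⇒name : ∀ a {u v} → J.Joined a u v → name a u ≡ name a v
    joined⇒name a u∼v = first-cong (λ w → dec a w _) (λ w → dec a w _)
      (λ w∼u → JP.joined-trans a w∼u u∼v) (λ w∼v → JP.joined-trans a w∼v (JP.joined-sym a u∼v)) vertices

    name⇒joined : ∀ a {u v} → name a u ≡ name a v → J.Joined a u v
    name⇒joined a {u} {v} eq =
      let w , w∼u , w∼v = first-injective (λ w → dec a w u) (λ w → dec a w v) (itself u) (itself v) eq
      in JP.joined-trans a (JP.joined-sym a w∼u) w∼v
      where
      itself : ∀ u → Any (λ w → J.Joined a w u) vertices
      itself u = Any.map (λ eq → inj₁ (sym eq)) (∈-vertices u)

    -- If every vertex had one of the listed names, the list, padded to r entries, would give a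
    -- cover by r components.
    uncovered : ∀ (L : List (Fin k × ℕ)) → length L ≤ r → ∃ λ q → All (λ (a , n) → name a q ≢ n) L
    uncovered L short with Any.any? (λ q → All.all? (λ (a , n) → ¬? (name a q ℕ.≟ n)) L) vertices
    ... | yes hit = let q , _ , off = find hit in q , off
    ... | no miss = ⊥-elim (uncoverable (component , (λ s → proj₁ (chosen s) , proj₂ (chosen s) , id , id) , covers))
      where
      color₀ = color λ i → fin (nonempty i)
      representative : Fin k × ℕ → Vertex
      representative (a , n) with Any.any? (λ u → name a u ℕ.≟ n) vertices
      ... | yes hit = proj₁ (find hit)
      ... | no _    = base
      representative-name : ∀ a q → name a (representative (a , name a q)) ≡ name a q
      representative-name a q with Any.any? (λ u → name a u ℕ.≟ name a q) vertices
      ... | yes hit = proj₂ (proj₂ (find hit))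
      ... | no none = contradiction (Any.map (λ { refl → refl }) (∈-vertices q)) none
      padded : Fin r → Fin k × ℕ
      padded = pad (color₀ , 0) L
      chosen : Fin r → Fin k × Vertex
      chosen s = proj₁ (padded s) , representative (padded s)
      component : Fin r → Pred Vertex 0ℓ
      component s = J.Joined (proj₁ (chosen s)) (proj₂ (chosen s))
      covers : ∀ v → ∃ λ s → component s v
      covers v with Any.any? (λ (a , n) → name a v ℕ.≟ n) L
      ... | yes hit = let (a , n) , an∈ , eq = find hit
                          s , at-s = ∈-pad (color₀ , 0) an∈ short
                      in s , subst (λ (a , n) → J.Joined a (representative (a , n)) v) (sym at-s)
                        (subst (λ n → J.Joined a (representative (a , n)) v) eq
                          (name⇒joined a (representative-name a v)))
      ... | no none = contradiction
        (Any.map (λ { refl → All.tabulate λ an∈ eq → none (lose an∈ eq) }) (∈-vertices v)) miss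

    system : System r k
    system = record
      { V         = Vertex
      ; cls       = proj₁
      ; name      = name
      ; inhabited = λ j → (j , fin (nonempty j)) , refl
      ; mono      = mono
      ; avoid     = avoid
      ; uncovered = uncovered
      }
      where
      mono : ∀ (e : Fin r → Vertex) → (∀ i → proj₁ (e i) ≡ i) →
        ∃ λ a → ∀ i j → name a (e i) ≡ name a (e j)
      mono e e∈ = color edge , λ i j → joined⇒name (color edge)
        (JP.same-edge (color edge) (edge , refl) (on-edge i) (on-edge j))
        where
        edge : Edge
        edge i = subst (Fin ∘ size) (e∈ i) (proj₂ (e i))
        on-edge : ∀ i → edge (proj₁ (e i)) ≡ proj₂ (e i)
        on-edge i = lift (e i) (e∈ i) refl
          where
          lift : ∀ {i} v (eq : proj₁ v ≡ i) → edge i ≡ subst (Fin ∘ size) eq (proj₂ v) → edge (proj₁ v) ≡ proj₂ v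
          lift v refl p = p
      -- If the vertex of class `j` tried first is joined to `u`, color `a` is used. A vertex `q`
      -- outside the component then lies, by spanning, on an edge of color `a`, whose vertex in
      -- class `j` is outside too.
      avoid : ∀ u a j → j ≢ proj₁ u → ∃ λ w → proj₁ w ≡ j × name a w ≢ name a u
      avoid u a j j≢ with dec a u (j , fin (nonempty j))
      ... | no u≁w = _ , refl , λ eq → u≁w (name⇒joined a (sym eq))
      ... | yes (inj₁ refl) = contradiction refl j≢
      ... | yes (inj₂ ((e , e-a) , _)) with uncovered ((a , name a u) ∷ []) (≤-trans (s≤s z≤n) (toℕ<n j))
      ...   | q , q≁u ∷ [] with spanning q a (e , e-a)
      ...     | f , q∈f , f-a = (j , f j) , refl , λ eq → q≁u (trans
                (joined⇒name a (JP.same-edge a (f , f-a) q∈f refl)) eq)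

no-system : ∀ {r} → 3 ≤ r → System r (2 * r ∸ 1) → ⊥
no-system {suc (suc (suc zero))}    3≤r S = no-tight S (Blocking.tight S 3≤r ≤-refl)
no-system {suc (suc (suc (suc s)))} 3≤r S =
  Profile.r≱4 S k+1≤2r (Blocking.tight S 3≤r k+1≤2r) s refl
  where
  r = 4 + s
  k+1≤2r : 2 * r ∸ 1 + 1 ≤ r + r
  k+1≤2r = ≤-reflexive (trans (m∸n+n≡m {2 * r} (s≤s z≤n)) (cong (r +_) (+-identityʳ r)))
no-system {suc (suc zero)} (s≤s (s≤s ()))
no-system {suc zero}       (s≤s ())

-- If n > r, minimality of n excludes a cover by r components, which gives a system.
cover-number≤r : ∀ {r} → 3 ≤ r → (K : CompletePartiteColoring r (2 * r ∸ 1)) →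
  CompletePartiteColoring.Spanning K → ∀ n → CompletePartiteColoring.IsCoverNumber K n → n ≤ r
cover-number≤r {suc r} 3≤r K spanning n (_ , least) = decidable-stable (n ℕ.≤? suc r) λ n≰r →
  U.¬¬-dec λ dec → no-system 3≤r (U.system dec λ cov → n≰r (least _ cov))
  where module U = Upper K spanning zero

-- The lower bound

-- Abstract, since unfolding the powers makes type checking intractable.
abstract
  words : ℕ → ℕ → ℕ
  words k n = k ^ n

  words-nonZero : ∀ k n → NonZero (words (suc (suc k)) n)
  words-nonZero k n = m^n≢0 (suc (suc k)) n

  word : ∀ {k n} → (Fin n → Fin k) → Fin (words k n)
  word = funToFin

  letter : ∀ {k n} → Fin (words k n) → Fin n → Fin k
  letter = finToFun

  letter-word : ∀ {k n} (f : Fin n → Fin k) i → letter (word f) i ≡ f i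
  letter-word = finToFun-funToFin

module Lower (s k′ : ℕ) (2r-2<k : (2 + s) + (2 + s) < 2 + k′) where

  r k : ℕ
  r = 3 + s
  k = 2 + k′

  -- A vertex has `suc (extra j)` marks: r - 1 in class 0 and one in every other class, 2r - 2 along
  -- an edge.
  extra : Fin r → ℕ
  extra zero    = suc s
  extra (suc _) = 0

  size : Fin r → ℕ
  size j = words k (3 + extra j)

  module _ {w : ℕ} where

    -- The letters of a vertex: a preferred color, a level, and marked colors.
    encode : Fin k → Fin k → (Fin (suc w) → Fin k) → Fin (words k (3 + w))
    encode p m T = word λ { zero → p ; (suc zero) → m ; (suc (suc i)) → T i }

    tag level : Fin (words k (3 + w)) → Fin k
    tag x   = letter x zero
    level x = letter x (suc zero)

    marks : Fin (words k (3 + w)) → Fin (suc w) → Fin k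
    marks x i = letter x (suc (suc i))

    tag-encode : ∀ p m T → tag (encode p m T) ≡ p
    tag-encode p m T = letter-word _ zero

    level-encode : ∀ p m T → level (encode p m T) ≡ m
    level-encode p m T = letter-word _ (suc zero)

    marks-encode : ∀ p m T i → marks (encode p m T) i ≡ T i
    marks-encode p m T i = letter-word _ (suc (suc i))

    -- Constant on the components of each color, with 0 for unmarked colors.
    value : Fin (words k (3 + w)) → Fin k → ℕ
    value x a with any? (λ i → marks x i ≟ a)
    ... | yes _ = suc (toℕ (level x))
    ... | no _  = 0

    value-marked : ∀ x {a} i → marks x i ≡ a → value x a ≡ suc (toℕ (level x))
    value-marked x {a} i eq with any? (λ i → marks x i ≟ a)
    ... | yes _   = refl
    ... | no none = contradiction (i , eq) none

    value-unmarked : ∀ x {a} → (∀ i → marks x i ≢ a) → value x a ≡ 0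
    value-unmarked x {a} none with any? (λ i → marks x i ≟ a)
    ... | yes (i , eq) = contradiction eq (none i)
    ... | no _         = refl

    value-encode-marked : ∀ p m T {a} i → T i ≡ a → value (encode p m T) a ≡ suc (toℕ m)
    value-encode-marked p m T i eq =
      trans (value-marked (encode p m T) i (trans (marks-encode p m T i) eq))
            (cong (suc ∘ toℕ) (level-encode p m T))

    value-encode-unmarked : ∀ p m T {a} → (∀ i → T i ≢ a) → value (encode p m T) a ≡ 0
    value-encode-unmarked p m T none = value-unmarked (encode p m T) λ i eq →
      none i (trans (sym (marks-encode p m T i)) eq)

  Edge : Set
  Edge = (j : Fin r) → Fin (size j)

  Vertex : Set
  Vertex = Σ (Fin r) (Fin ∘ size)

  valueᵥ : Vertex → Fin k → ℕ
  valueᵥ (j , x) = value x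

  -- Edges are functions; vectors turn pointwise equality of edges into equality of tables, as
  -- `color-cong` requires.
  Table : Set
  Table = Vec (Vec ℕ k) r

  entry : Table → Fin r → Fin k → ℕ
  entry t j a = Vec.lookup (Vec.lookup t j) a

  Constant : Table → Fin k → Set
  Constant t a = ∀ j → entry t j a ≡ entry t zero a

  constant? : ∀ t → Decidable (Constant t)
  constant? t a = all? λ j → entry t j a ℕ.≟ entry t zero a

  abstract
    choose : Fin k → Table → Fin k
    choose p t with constant? t p
    ... | yes _ = p
    ... | no _ with any? (constant? t)
    ...   | yes (a , _) = a
    ...   | no _        = p

    choose-constant : ∀ p t → ∃ (Constant t) → Constant t (choose p t)
    choose-constant p t some with constant? t p
    ... | yes p-const = p-const
    ... | no _ with any? (constant? t)
    ...   | yes (_ , a-const) = a-const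
    ...   | no none           = contradiction some none

    choose-preferred : ∀ p t → Constant t p → choose p t ≡ p
    choose-preferred p t p-const with constant? t p
    ... | yes _ = refl
    ... | no ¬p = contradiction p-const ¬p

  table : Edge → Table
  table e = Vec.tabulate λ j → Vec.tabulate (value (e j))

  table-lookup : ∀ e j a → entry (table e) j a ≡ value (e j) a
  table-lookup e j a = trans (cong (λ v → Vec.lookup v a) (lookup∘tabulate (λ j → Vec.tabulate (value (e j))) j))
    (lookup∘tabulate (value (e j)) a)

  -- Still a after changing one argument of `majority a a a`: this lets any
  -- vertex lie in an edge that prefers a given color.
  majority : Fin k → Fin k → Fin k → Fin k
  majority a b c with b ≟ c
  ... | yes _ = b
  ... | no _  = a

  preferred : Edge → Fin k
  preferred e = majority (tag (e zero)) (tag (e (suc zero))) (tag (e (suc (suc zero))))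

  color : Edge → Fin k
  color e = choose (preferred e) (table e)

  color-cong : ∀ {e f : Edge} → (∀ j → e j ≡ f j) → color e ≡ color f
  color-cong {e} {f} e≗f = cong₂ choose preferred≡ table≡
    where
    table≡ : table e ≡ table f
    table≡ = tabulate-cong λ j → cong (Vec.tabulate ∘ value) (e≗f j)
    preferred≡ : preferred e ≡ preferred f
    preferred≡ = trans
      (cong (λ a → majority a (tag (e (suc zero))) (tag (e (suc (suc zero))))) (cong tag (e≗f zero)))
      (cong₂ (majority (tag (f zero))) (cong tag (e≗f (suc zero))) (cong tag (e≗f (suc (suc zero)))))

  K : CompletePartiteColoring r k
  K = record
    { size       = size
    ; nonempty   = λ j → words-nonZero k′ (3 + extra j)
    ; color      = color
    ; color-cong = color-cong
    }

  open CompletePartiteColoring K using (Spanning; IsCoverNumber; coloredHypergraph)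
  open ColoredHypergraph coloredHypergraph using (colorClass; CoveredBy)

  -- The 2r - 2 marks along an edge miss one of the k colors, and in that color every vertex has
  -- value 0.
  unmarked-color : ∀ e → ∃ (Constant (table e))
  unmarked-color e = a , λ j → trans (zero-at j) (sym (zero-at zero))
    where
    mark : Fin (2 + s) ⊎ Fin (2 + s) → Fin k
    mark = [ marks (e zero) , (λ j → marks (e (suc j)) zero) ]
    all-marks : Fin ((2 + s) + (2 + s)) → Fin k
    all-marks = mark ∘ splitAt (2 + s)
    free = missed _≟_ 2r-2<k all-marks id id
    a = proj₁ free
    unmarked : ∀ j i → marks (e j) i ≢ a
    unmarked zero    i    eq = proj₂ free (i ↑ˡ (2 + s))
      (trans (cong mark (splitAt-↑ˡ (2 + s) i (2 + s))) eq)
    unmarked (suc j) zero eq = proj₂ free ((2 + s) ↑ʳ j)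
      (trans (cong mark (splitAt-↑ʳ (2 + s) (2 + s) j)) eq)
    zero-at : ∀ j → entry (table e) j a ≡ 0
    zero-at j = trans (table-lookup e j a) (value-unmarked (e j) (unmarked j))

  value-constant : ∀ e i j → value (e i) (color e) ≡ value (e j) (color e)
  value-constant e i j = trans (to-zero i) (sym (to-zero j))
    where
    to-zero : ∀ j → value (e j) (color e) ≡ value (e zero) (color e)
    to-zero j = trans (sym (table-lookup e j (color e)))
      (trans (choose-constant (preferred e) (table e) (unmarked-color e) j) (table-lookup e zero (color e)))

  module J (a : Fin k) = Hypergraph (colorClass a)

  value-joined : ∀ {a u v} → J.Joined a u v → valueᵥ u a ≡ valueᵥ v a
  value-joined (inj₁ refl) = refl
  value-joined {a} (inj₂ (e , f , u∈ , v∈ , path)) = along e path u∈ v∈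
    where
    within : ∀ (e : J.Edge a) {u v} → J._∈_ a u e → J._∈_ a v e → valueᵥ u a ≡ valueᵥ v a
    within (e , refl) refl refl = value-constant e _ _
    along : ∀ e {f} → Star (J.Intersects a) e f → ∀ {u v} → J._∈_ a u e → J._∈_ a v f → valueᵥ u a ≡ valueᵥ v a
    along e ε                      u∈ v∈ = within e u∈ v∈
    along e ((w , w∈e , w∈g) ◅ path) u∈ v∈ = trans (within e u∈ w∈e) (along _ path w∈g v∈)

  -- Edges of a prescribed color

  other : Fin k → Fin k
  other zero    = suc zero
  other (suc _) = zero

  other-≢ : ∀ a → other a ≢ a
  other-≢ zero    ()
  other-≢ (suc _) ()

  -- All vertices prefer `a`. With `c = a` their value in `a` is that of level `m`; with
  -- `c = other a` it is 0.
  base : Fin k → Fin k → Fin k → Edge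
  base a m c j = encode a m (const c)

  put : Vertex → Edge → Edge
  put (i , x) e j with i ≟ j
  ... | yes refl = x
  ... | no _     = e j

  put-∈ : ∀ i x e → put (i , x) e i ≡ x
  put-∈ i x e with i ≟ i
  ... | yes refl = refl
  ... | no ≢     = contradiction refl ≢

  put-≢ : ∀ i x e {j} → i ≢ j → put (i , x) e j ≡ e j
  put-≢ i x e {j} i≢j with i ≟ j
  ... | yes eq = contradiction eq i≢j
  ... | no _   = refl

  majority-≡ : ∀ a {b c} → b ≡ c → majority a b c ≡ b
  majority-≡ a {b} {c} eq with b ≟ c
  ... | yes _ = refl
  ... | no ≢  = contradiction eq ≢

  majority-outer : ∀ {a b c d} → a ≡ d → b ≡ d ⊎ c ≡ d → majority a b c ≡ d
  majority-outer {b = b} {c} a≡ bc≡ with b ≟ c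
  ... | no _ = a≡
  majority-outer a≡ (inj₁ b≡) | yes refl = b≡
  majority-outer a≡ (inj₂ c≡) | yes refl = c≡

  preferred-put : ∀ v a m c → preferred (put v (base a m c)) ≡ a
  preferred-put (zero , x) a m c =
    trans (majority-≡ _ (trans (tag-encode _ _ _) (sym (tag-encode _ _ _)))) (tag-encode _ _ _)
  preferred-put (suc zero , x) a m c = majority-outer {b = tag x} (tag-encode _ _ _) (inj₂ (tag-encode _ _ _))
  preferred-put v@(suc (suc j) , x) a m c = majority-outer {c = tag (put v (base a m c) (suc (suc zero)))}
    (tag-encode _ _ _) (inj₁ (tag-encode _ _ _))

  color-preferred : ∀ e {a n} → preferred e ≡ a → (∀ j → value (e j) a ≡ n) → color e ≡ a
  color-preferred e refl const-n = choose-preferred _ _ λ j →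
    trans (trans (table-lookup e j _) (const-n j)) (sym (trans (table-lookup e zero _) (const-n zero)))

  color-base : ∀ {a m c n} → (∀ j → value (base a m c j) a ≡ n) → color (base a m c) ≡ a
  color-base {a} {m} {c} = color-preferred (base a m c)
    (majority-outer (tag-encode _ _ _) (inj₁ (tag-encode _ _ _)))

  color-put : ∀ v {a m c} → (∀ j → value (base a m c j) a ≡ valueᵥ v a) → color (put v (base a m c)) ≡ a
  color-put v@(i , x) {a} {m} {c} const-n = color-preferred (put v (base a m c)) (preferred-put v a m c) agrees
    where
    agrees : ∀ j → value (put v (base a m c) j) a ≡ value x a
    agrees j with i ≟ j
    ... | yes refl = refl
    ... | no _     = const-n j

  -- The rest of the edge is given the same value in `a` as `v`: by the level of `v` if `v` marks
  -- `a`, and by leaving `a` unmarked otherwise.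
  spanning : Spanning
  spanning v@(i , x) a _ with any? (λ s → marks x s ≟ a)
  ... | yes (s , eq) = put v (base a (level x) a) , put-∈ i x _ , color-put v λ j →
    trans (value-encode-marked a (level x) (const a) zero refl) (sym (value-marked x s eq))
  ... | no none = put v (base a zero (other a)) , put-∈ i x _ , color-put v λ j →
    trans (value-encode-unmarked a zero (const (other a)) (const (other-≢ a)))
      (sym (value-unmarked x λ s eq → none (s , eq)))

  -- A vertex has at most r - 1 marks, so it leaves one of the r colors `hue i` unmarked and is
  -- joined to the center of that color.
  covered : CoveredBy r
  covered = (λ i → J.Joined (hue i) (center i)) , (λ i → hue i , center i , id , id) , covers
    where
    r≤k : r ≤ k
    r≤k = ≤-trans (s≤s (m≤m+n (2 + s) (2 + s))) 2r-2<k
    hue : Fin r → Fin k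
    hue i = inject≤ i r≤k
    plain : Fin k → Edge
    plain a = base a zero (other a)
    center : Fin r → Vertex
    center i = zero , plain (hue i) zero
    plain-value : ∀ a j → value (plain a j) a ≡ 0
    plain-value a j = value-encode-unmarked a zero (const (other a)) (const (other-≢ a))
    elsewhere : ∀ (j : Fin r) → ∃ λ j′ → j ≢ j′
    elsewhere zero    = suc zero , λ ()
    elsewhere (suc _) = zero , λ ()
    few-marks : ∀ j → suc (extra j) < r
    few-marks zero    = ≤-refl
    few-marks (suc _) = s≤s (s≤s z≤n)
    covers : ∀ v → ∃ λ i → J.Joined (hue i) (center i) v
    covers v@(j , x) =
      let i , unmarked = missed _≟_ (few-marks j) (marks x) hue (inject≤-injective r≤k r≤k _ _)
          a = hue i
          j′ , j≢j′ = elsewhere j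
      -- `plain a` and the edge obtained from it by inserting `v` meet in a class `j′` other than
      -- that of `v`.
      in i , inj₂ ( (plain a , color-base (plain-value a))
                  , (put v (plain a) , color-put v λ l → trans (plain-value a l) (sym (value-unmarked x unmarked)))
                  , refl , put-∈ j x _
                  , ((j′ , plain a j′) , refl , put-≢ j x _ j≢j′) ◅ ε)

  -- Fewer than r components have at most r - 1 colors, which all fit among the marks of a vertex of
  -- class 0.
  covered⇒r≤ : ∀ n → CoveredBy n → r ≤ n
  covered⇒r≤ n (C , component , covers) = ≮⇒≥ λ n<r →
    let hue = λ i → proj₁ (component i)
        center = λ i → proj₁ (proj₂ (component i))
        -- As n < k, some level gives a value different from those of all centers.
        m , fresh = missed ℕ._≟_ (<-trans n<r r<k) (λ i → valueᵥ (center i) (hue i)) (suc ∘ toℕ)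
              (toℕ-injective ∘ suc-injective)
        marked = pad zero (List.tabulate hue)
        v = zero , encode zero m marked
        i , v∈ = covers v
        l , at-l = ∈-pad zero (∈-tabulate⁺ i) (≤-trans (≤-reflexive (length-tabulate hue)) (≤-pred n<r))
    in fresh i (trans (value-joined (proj₁ (proj₂ (proj₂ (component i))) v∈))
         (value-encode-marked zero m marked l at-l))
    where
    r<k : r < k
    r<k = ≤-<-trans (+-monoˡ-≤ (2 + s) (s≤s (z≤n {suc s}))) 2r-2<k

cover-number-attained : ∀ s k′ → (2 + s) + (2 + s) < 2 + k′ →
  Σ (CompletePartiteColoring (3 + s) (2 + k′)) λ K →
    CompletePartiteColoring.Spanning K × CompletePartiteColoring.IsCoverNumber K (3 + s)
cover-number-attained s k′ lt = K , spanning , covered , covered⇒r≤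
  where open Lower s k′ lt

theorem2p7 : (r : ℕ) → 3 ≤ r → IsCov r (2 * r ∸ 1) r
theorem2p7 (suc (suc (suc s))) 3≤r =
  -- With k = 2r - 1 the number 2r - 2 of marks along an edge is just below k.
  cover-number-attained s _ (≤-reflexive (rearrange s)) ,
  λ n (K , spanning , number) → cover-number≤r 3≤r K spanning n number
  where
  rearrange : ∀ s → suc ((2 + s) + (2 + s)) ≡ 2 * (3 + s) ∸ 1
  rearrange s = trans (sym (+-suc (2 + s) (2 + s))) (cong ((2 + s) +_) (sym (+-identityʳ (3 + s))))
theorem2p7 (suc (suc zero)) (s≤s (s≤s ()))
theorem2p7 (suc zero)       (s≤s ())
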